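{- $\mathrm{PrCat}(\omega*\eta)=\mathrm{Cone}(\Delta^0_3)$.
   Context: $\eta$ is the order type of the rationals and $\omega$ that of the naturals. For linear orders $L_0,L_1$, $L_0*L_1$ is the linear order obtained by replacing each point of $L_1$ with a copy of $L_0$; thus $\omega*\eta$ is a dense-without-endpoints sequence of copies of $\omega$. A structure is punctual if its domain is $\omega$ and its relations are uniformly primitive recursive. For total $f,g:\omega\to\omega$, write $f\le_{PR}g$ if $f$ is primitive recursive relative to $g$; the induced equivalence classes are PR-degrees, and $f\le_{PR}\mathbf d$ means $f\le_{PR}$ a member of $\mathbf d$. For a punctual structure $A$, $\mathrm{PrCat}(A)$ is the set of PR-degrees $\mathbf d$ such that for every punctual $B\cong A$ there is an isomorphism $f:A\to B$ with $f\le_{PR}\mathbf d$ and $f^{ -1}\le_{PR}\mathbf d$; for an isomorphism type $S$ with a punctual presentation, $\mathrm{PrCat}(S)$ means $\mathrm{PrCat}(A)$ for a punctual $A\cong S$ (this does not depend on the choice of $A$). $\mathrm{Cone}(\Delta^0_3)$ is the set of PR-degrees $\mathbf d$ such that $f\le_{PR}\mathbf d$ for every total $\Delta^0_3$ function $f:\omega\to\omega$. -}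

module Defs where

open import Data.Nat using (ℕ; zero; suc; _<_)
open import Data.Fin using (Fin)
open import Data.Vec using (Vec; []; _∷_; lookup)
open import Data.Product using (Σ; _×_; _,_; ∃)
open import Data.Sum using (_⊎_)
open import Data.Rational as ℚ using (ℚ)
open import Relation.Binary.PropositionalEquality using (_≡_)

data PR : ℕ → Set where
  zer  : ∀ {n} → PR n
  sucF : PR 1
  proj : ∀ {n} → Fin n → PR n
  comp : ∀ {m n} → PR m → Vec (PR n) m → PR n
  prec : ∀ {n} → PR n → PR (suc (suc n)) → PR (suc n)
  orc  : PR 1

mutual
  eval : (ℕ → ℕ) → ∀ {n} → PR n → Vec ℕ n → ℕ
  eval g zer xs = 0
  eval g sucF (x ∷ []) = suc x
  eval g (proj i) xs = lookup xs i
  eval g (comp h hs) xs = eval g h (evals g hs xs)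
  eval g (prec b s) (k ∷ xs) = evalRec g b s k xs
  eval g orc (x ∷ []) = g x

  evals : (ℕ → ℕ) → ∀ {m n} → Vec (PR n) m → Vec ℕ n → Vec ℕ m
  evals g [] xs = []
  evals g (h ∷ hs) xs = eval g h xs ∷ evals g hs xs

  evalRec : (ℕ → ℕ) → ∀ {n} → PR n → PR (suc (suc n)) → ℕ → Vec ℕ n → ℕ
  evalRec g b s zero xs = eval g b xs
  evalRec g b s (suc k) xs = eval g s (k ∷ evalRec g b s k xs ∷ xs)

-- Unrelativised primitive recursion: the oracle is the constant-0
-- function (which is itself primitive recursive, so nothing is gained).
evalPR : ∀ {n} → PR n → Vec ℕ n → ℕ
evalPR = eval (λ _ → 0)

_≤PR_ : (ℕ → ℕ) → (ℕ → ℕ) → Set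
f ≤PR g = Σ (PR 1) λ t → ∀ x → eval g t (x ∷ []) ≡ f x

-- Punctual linear-order-signature structures: domain ω, the (strict)
-- order relation has a primitive recursive characteristic function.

record Punctual : Set where
  field
    rel : PR 2

Rel : Punctual → ℕ → ℕ → Set
Rel A x y = evalPR (Punctual.rel A) (x ∷ y ∷ []) ≡ 1

record _≅_ {X Y : Set} (R : X → X → Set) (S : Y → Y → Set) : Set where
  field
    to      : X → Y
    from    : Y → X
    from∘to : ∀ x → from (to x) ≡ x
    to∘from : ∀ y → to (from y) ≡ y
    pres    : ∀ x y → (R x y → S (to x) (to y)) × (S (to x) (to y) → R x y)

open _≅_ public

-- The order type ω*η: ℕ × ℚ ordered lexicographically, comparing the
-- ℚ-coordinate first (each rational replaced by a copy of ω).

_<ωη_ : ℕ × ℚ → ℕ × ℚ → Set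
(n , q) <ωη (m , r) = (q ℚ.< r) ⊎ ((q ≡ r) × (n < m))

Σ3Graph : (ℕ → ℕ) → Set
Σ3Graph f = Σ (PR 5) λ R → ∀ x y →
  (f x ≡ y → ∃ λ a → ∀ b → ∃ λ c → evalPR R (x ∷ y ∷ a ∷ b ∷ c ∷ []) ≡ 0)
  × ((∃ λ a → ∀ b → ∃ λ c → evalPR R (x ∷ y ∷ a ∷ b ∷ c ∷ []) ≡ 0) → f x ≡ y)

Π3Graph : (ℕ → ℕ) → Set
Π3Graph f = Σ (PR 5) λ R → ∀ x y →
  (f x ≡ y → ∀ a → ∃ λ b → ∀ c → evalPR R (x ∷ y ∷ a ∷ b ∷ c ∷ []) ≡ 0)
  × ((∀ a → ∃ λ b → ∀ c → evalPR R (x ∷ y ∷ a ∷ b ∷ c ∷ []) ≡ 0) → f x ≡ y)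

Δ3 : (ℕ → ℕ) → Set
Δ3 f = Σ3Graph f × Π3Graph f

-- Degree classes, given through a representative d of the PR-degree
-- (both notions are invariant under ≡_PR).

Cone : (ℕ → ℕ) → Set
Cone d = ∀ (f : ℕ → ℕ) → Δ3 f → f ≤PR d

PrCat : Punctual → (ℕ → ℕ) → Set
PrCat A d = ∀ (B : Punctual) → Rel A ≅ Rel B →
  Σ (Rel A ≅ Rel B) λ i → (to i ≤PR d) × (from i ≤PR d)

{-# OPTIONS --safe #-}

-- Let x ≪ y mean that infinitely many points lie between x and y.  In a copy of ω*η the relation
-- ≪ is a dense order of the blocks, and it is Π₂.
--
-- Upper bound.  Send x to its position in its block and to the rational that Cantor's "forth"
-- construction assigns to its block.  Both coordinates have Σ₃ graphs, so any two punctual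
-- copies are isomorphic by a Δ₃ map with Δ₃ inverse.
--
-- Lower bound.  If f x ≡ y is Σ₃, then f x is the first component of the least k satisfying a
-- certain Π₂ condition W x k.  Build a copy C in which, for every x, the markers
-- … < p₂ < p₁ < p₀ are such that p₀, …, p_k lie in one block up to the least k satisfying W x k,
-- and p_{k+1} ≪ p_k: the interval (p_{j+1}, p_j) receives a new point whenever the Π₂ condition
-- "W x i for some i ≤ j" makes progress.  Take also a copy N in which ≪ is primitive recursive
-- and every block is ordered as a set of natural numbers.  An isomorphism C → N maps p₀, …, p_k
-- to a decreasing sequence of numbers, so k is found by a search bounded by the image of p₀.
module Submission where

open import Defs
open import Level using (0ℓ)
open import Axiom.ExcludedMiddle using (ExcludedMiddle)
open import Data.Empty using (⊥-elim)
open import Data.Fin using (Fin; suc; toℕ; fromℕ<)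
open import Data.Fin.Patterns
open import Data.Fin.Properties using (injective⇒≤; fromℕ<-injective; toℕ-injective; toℕ<n)
open import Data.Integer as ℤ using (_⊖_; -[1+_]) renaming (+_ to pos)
import Data.Integer.Properties as ℤ
open import Data.Nat hiding (compare)
open import Data.Nat.Induction using (<-rec)
open import Data.Nat.Properties
open import Data.Product using (Σ; _×_; _,_; proj₁; proj₂; ∃)
open import Data.Rational as ℚ using (ℚ; mkℚ)
import Data.Rational.Properties as ℚ
open import Data.Rational.Unnormalised as ℚᵘ using (mkℚᵘ; *<*)
import Data.Rational.Unnormalised.Properties as ℚᵘ
open import Data.Sum as Sum using (_⊎_; inj₁; inj₂)
open import Data.Vec using (Vec; []; _∷_; lookup; map; tail; tabulate)
open import Data.Vec.Properties using (tabulate∘lookup)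
open import Function using (_∘_; case_of_)
open import Relation.Binary using (tri<; tri≈; tri>)
open import Relation.Binary.PropositionalEquality
open import Relation.Nullary using (¬_; Dec; yes; no; _×-dec_)

-- Primitive recursion has no unbounded search, so it does not help that a separated pair of
-- neighbouring markers is certain to exist: a bound on k is indispensable. It comes from the blocks
-- having type ω, since a decreasing run of natural numbers that starts at n has at most n steps;
-- this is why the markers descend. The interval (p_{j+1}, p_j) has to become either finite or a
-- dense stack of infinite blocks, and the construction never learns which. Hence each new point is
-- filed under a rational from a list that repeats every non-negative rational infinitely often:
-- points that keep coming fill every block, and finitely many points are absorbed by the block
-- above them. For the upper bound, each step of "forth" is a condition on the finite list of
-- earlier choices, built from ≪ and comparisons of rationals. So a coded list of choices, all of
-- them checked, gives a Σ₃ definition.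

infix 1 _⟺_
_⟺_ : Set → Set → Set
P ⟺ Q = (P → Q) × (Q → P)

-- Closure properties of relative primitive recursion

natRec : {A : Set} → A → (ℕ → A → A) → ℕ → A
natRec z s zero    = z
natRec z s (suc n) = s n (natRec z s n)

ifZero : ℕ → ℕ → ℕ → ℕ
ifZero n x y = natRec x (λ _ _ → y) n

-- The oracle stays a parameter because the same closure lemmas serve the punctual copies
-- (`zero-oracle`) and the decoding relative to `d`.
record PrimRec (g : ℕ → ℕ) {n} (F : Vec ℕ n → ℕ) : Set where
  constructor primRec
  field
    term    : PR n
    correct : ∀ xs → eval g term xs ≡ F xs

record PrimRecs (g : ℕ → ℕ) {m n} (G : Vec ℕ n → Vec ℕ m) : Set where
  constructor primRecs
  field
    terms    : Vec (PR n) m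
    corrects : ∀ xs → evals g terms xs ≡ G xs

-- The terms are abstract because only the functions they compute matter, and unfolding the terms
-- makes conversion checking infeasible.
module _ {g : ℕ → ℕ} where

  abstract
    var : ∀ {n} (i : Fin n) → PrimRec g (λ xs → lookup xs i)
    var i = primRec (proj i) λ _ → refl

    []ᵖ : ∀ {n} → PrimRecs g {n = n} (λ _ → [])
    []ᵖ = primRecs [] λ _ → refl

    infixr 5 _∷ᵖ_
    _∷ᵖ_ : ∀ {m n} {F : Vec ℕ n → ℕ} {G : Vec ℕ n → Vec ℕ m} →
           PrimRec g F → PrimRecs g G → PrimRecs g (λ xs → F xs ∷ G xs)
    primRec t p ∷ᵖ primRecs ts ps = primRecs (t ∷ ts) λ xs → cong₂ _∷_ (p xs) (ps xs)

    sub : ∀ {m n} {F : Vec ℕ m → ℕ} {G : Vec ℕ n → Vec ℕ m} →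
          PrimRec g F → PrimRecs g G → PrimRec g (F ∘ G)
    sub {F = F} (primRec t p) (primRecs ts ps) =
      primRec (comp t ts) λ xs → trans (p (evals g ts xs)) (cong F (ps xs))

    infixr 9 _⨟_
    _⨟_ : ∀ {l m n} {G : Vec ℕ l → Vec ℕ m} {H : Vec ℕ m → Vec ℕ n} →
          PrimRecs g G → PrimRecs g H → PrimRecs g (H ∘ G)
    _⨟_ {H = H} (primRecs us p) (primRecs ts q) =
      primRecs (map (λ t → comp t us) ts) λ xs →
        trans (evals-comp ts xs) (trans (q (evals g us xs)) (cong H (p xs)))
      where
      evals-comp : ∀ {n} (ts : Vec (PR _) n) xs →
                   evals g (map (λ t → comp t us) ts) xs ≡ evals g ts (evals g us xs)
      evals-comp []       xs = refl
      evals-comp (t ∷ ts) xs = cong (_ ∷_) (evals-comp ts xs)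

    cast : ∀ {n} {F G : Vec ℕ n → ℕ} → (∀ xs → F xs ≡ G xs) → PrimRec g F → PrimRec g G
    cast e (primRec t p) = primRec t λ xs → trans (p xs) (e xs)

    private
      evals-projections : ∀ {m n} (ρ : Fin m → Fin n) (xs : Vec ℕ n) →
                   evals g (tabulate (proj ∘ ρ)) xs ≡ tabulate (lookup xs ∘ ρ)
      evals-projections {zero}  ρ xs = refl
      evals-projections {suc m} ρ xs = cong (_ ∷_) (evals-projections (ρ ∘ suc) xs)

    idᵖ : ∀ {n} → PrimRecs g {n = n} (λ xs → xs)
    idᵖ = primRecs (tabulate proj) λ xs → trans (evals-projections (λ i → i) xs) (tabulate∘lookup xs)

    tailᵖ : ∀ {m n} {G : Vec ℕ n → Vec ℕ (suc m)} → PrimRecs g G → PrimRecs g (tail ∘ G)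
    tailᵖ {G = G} (primRecs (_ ∷ ts) ps) = primRecs ts λ xs → cong tail (ps xs)

    wk : ∀ {n} {F : Vec ℕ n → ℕ} → PrimRec g F → PrimRec g (F ∘ tail)
    wk p = sub p (tailᵖ idᵖ)

    recᵖ : ∀ {n} {B : Vec ℕ n → ℕ} {S : Vec ℕ (2 + n) → ℕ} {K : Vec ℕ n → ℕ} →
           PrimRec g B → PrimRec g S → PrimRec g K →
           PrimRec g (λ xs → natRec (B xs) (λ k r → S (k ∷ r ∷ xs)) (K xs))
    recᵖ {n} {B} {S} {K} (primRec b pb) (primRec s ps) k =
      cast (λ xs → go (K xs) xs) (sub (primRec (prec b s) λ _ → refl) (k ∷ᵖ idᵖ))
      where
      go : ∀ k xs → eval g (prec b s) (k ∷ xs) ≡ natRec (B xs) (λ k r → S (k ∷ r ∷ xs)) k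
      go zero    xs = pb xs
      go (suc k) xs = trans (ps _) (cong (λ r → S (k ∷ r ∷ xs)) (go k xs))

    sucᵖ : ∀ {n} {F : Vec ℕ n → ℕ} → PrimRec g F → PrimRec g (suc ∘ F)
    sucᵖ (primRec t p) = primRec (comp sucF (t ∷ [])) λ xs → cong suc (p xs)

    const : ∀ {n} (k : ℕ) → PrimRec g {n} (λ _ → k)
    const zero    = primRec zer λ _ → refl
    const (suc k) = sucᵖ (const k)

  module _ {n} {F G : Vec ℕ n → ℕ} where

    infixl 6 _+ᵖ_ _∸ᵖ_

    abstract
      _+ᵖ_ : PrimRec g F → PrimRec g G → PrimRec g (λ xs → F xs + G xs)
      p +ᵖ q = cast (λ xs → go (F xs) (G xs)) (recᵖ q (sucᵖ (var 1F)) p)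
        where
        go : ∀ x y → natRec y (λ _ → suc) x ≡ x + y
        go zero    y = refl
        go (suc x) y = cong suc (go x y)

      _∸ᵖ_ : PrimRec g F → PrimRec g G → PrimRec g (λ xs → F xs ∸ G xs)
      -- The inner recursion returns its counter and so computes the predecessor.
      p ∸ᵖ q = cast (λ xs → go (F xs) (G xs)) (recᵖ p (recᵖ (const 0) (var 0F) (var 1F)) q)
        where
        natRec≡pred : ∀ n → natRec 0 (λ k _ → k) n ≡ pred n
        natRec≡pred zero    = refl
        natRec≡pred (suc n) = refl

        go : ∀ x y → natRec x (λ _ r → natRec 0 (λ k _ → k) r) y ≡ x ∸ y
        go x zero    = refl
        go x (suc y) = trans (natRec≡pred (natRec x _ y))
                             (trans (cong pred (go x y)) (pred[m∸n]≡m∸[1+n] x y))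

  abstract
    infixl 7 _*ᵖ_
    _*ᵖ_ : ∀ {n} {F G : Vec ℕ n → ℕ} →
           PrimRec g F → PrimRec g G → PrimRec g (λ xs → F xs * G xs)
    _*ᵖ_ {F = F} {G} p q =
      cast (λ xs → go (F xs) (G xs)) (recᵖ (const 0) (wk (wk q) +ᵖ var 1F) p)
      where
      go : ∀ x y → natRec 0 (λ _ r → y + r) x ≡ x * y
      go zero    y = refl
      go (suc x) y = cong (y +_) (go x y)

    ifZeroᵖ : ∀ {n} {F G H : Vec ℕ n → ℕ} → PrimRec g F → PrimRec g G → PrimRec g H →
              PrimRec g (λ xs → ifZero (F xs) (G xs) (H xs))
    ifZeroᵖ p q r = recᵖ q (wk (wk r)) p

-- Cantor's pairing function

abstract
  tri : ℕ → ℕ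
  tri = natRec 0 (λ k r → r + suc k)

  -- The antidiagonal of `n`, that is the largest `d` with `tri d ≤ n`; it moves on exactly when
  -- `suc n` reaches `tri (suc d)`.
  diag : ℕ → ℕ
  diag = natRec 0 (λ n d → ifZero (tri (suc d) ∸ suc n) (suc d) d)

  ⟨_,_⟩ : ℕ → ℕ → ℕ
  ⟨ a , b ⟩ = tri (a + b) + b

  π₂ : ℕ → ℕ
  π₂ n = n ∸ tri (diag n)

  π₁ : ℕ → ℕ
  π₁ n = diag n ∸ π₂ n

  diag-spec : ∀ n → tri (diag n) ≤ n × n < tri (suc (diag n))
  diag-spec zero = z≤n , s≤s z≤n
  diag-spec (suc n) with diag-spec n | tri (suc (diag n)) ∸ suc n in eq
  ... | lo , hi | zero  = ≤-reflexive (≤-antisym (m∸n≡0⇒m≤n eq) hi) ,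
    ≤-<-trans hi (m<m+n _ z<s)
  ... | lo , hi | suc _ = m≤n⇒m≤1+n lo ,
    ≰⇒> λ le → 0≢1+n (trans (sym (m≤n⇒m∸n≡0 le)) eq)

  tri-mono : ∀ {m n} → m ≤ n → tri m ≤ tri n
  tri-mono {zero}  {n}     _       = z≤n
  tri-mono {suc m} {suc n} (s≤s p) = +-mono-≤ (tri-mono p) (s≤s p)

  diag-unique : ∀ {n d} → tri d ≤ n → n < tri (suc d) → diag n ≡ d
  diag-unique {n} {d} lo hi with diag-spec n
  ... | lo' , hi' = ≤-antisym
    (≮⇒≥ λ lt → <-irrefl refl (<-≤-trans hi (≤-trans (tri-mono lt) lo')))
    (≮⇒≥ λ lt → <-irrefl refl (<-≤-trans hi' (≤-trans (tri-mono lt) lo)))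

  diag-pair : ∀ a b → diag ⟨ a , b ⟩ ≡ a + b
  diag-pair a b = diag-unique (m≤m+n _ b) (+-monoʳ-< (tri (a + b)) (s≤s (m≤n+m b a)))

  π₂-pair : ∀ a b → π₂ ⟨ a , b ⟩ ≡ b
  π₂-pair a b rewrite diag-pair a b = m+n∸m≡n (tri (a + b)) b

  π₁-pair : ∀ a b → π₁ ⟨ a , b ⟩ ≡ a
  π₁-pair a b rewrite π₂-pair a b | diag-pair a b = m+n∸n≡m a b

  pair-π : ∀ n → ⟨ π₁ n , π₂ n ⟩ ≡ n
  pair-π n = trans (cong (λ d → tri d + π₂ n) (m∸n+n≡m π₂≤diag)) (m+[n∸m]≡n lo)
    where
    lo : tri (diag n) ≤ n
    lo = proj₁ (diag-spec n)
    π₂≤diag : π₂ n ≤ diag n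
    π₂≤diag = ≤-pred (+-cancelˡ-< (tri (diag n)) _ _
      (subst (_< tri (suc (diag n))) (sym (m+[n∸m]≡n lo)) (proj₂ (diag-spec n))))

  n≤tri : ∀ n → n ≤ tri n
  n≤tri zero    = z≤n
  n≤tri (suc n) = m≤n+m (suc n) (tri n)

  fst≤pair : ∀ a b → a ≤ ⟨ a , b ⟩
  fst≤pair a b = ≤-trans (m≤m+n a b) (≤-trans (n≤tri (a + b)) (m≤m+n _ b))

  snd≤pair : ∀ a b → b ≤ ⟨ a , b ⟩
  snd≤pair a b = m≤n+m b _

  -- A number s codes the infinite sequence π₁ s, π₁ (π₂ s), π₁ (π₂ (π₂ s)), ….

  entry : ℕ → ℕ → ℕ
  entry s i = π₁ (natRec s (λ _ r → π₂ r) i)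

  entry-suc : ∀ s i → entry s (suc i) ≡ entry (π₂ s) i
  entry-suc s i = cong π₁ (go i)
    where
    go : ∀ i → π₂ (natRec s (λ _ r → π₂ r) i) ≡ natRec (π₂ s) (λ _ r → π₂ r) i
    go zero    = refl
    go (suc i) = cong π₂ (go i)

  encode : (h : ℕ → ℕ) → ∀ n → ∃ λ s → ∀ i → i < n → entry s i ≡ h i
  encode h zero = 0 , λ _ ()
  encode h (suc n) with encode (h ∘ suc) n
  ... | s , p = ⟨ h 0 , s ⟩ , λ where
    zero    _         → π₁-pair (h 0) s
    (suc i) (s≤s i<n) → trans (entry-suc _ i)
      (trans (cong (λ r → entry r i) (π₂-pair (h 0) s)) (p i i<n))

module _ {g : ℕ → ℕ} {n} {F : Vec ℕ n → ℕ} (p : PrimRec g F) where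

  abstract
    triᵖ : PrimRec g (tri ∘ F)
    triᵖ = recᵖ (const 0) (var 1F +ᵖ sucᵖ (var 0F)) p

module _ {g : ℕ → ℕ} {n} {F : Vec ℕ n → ℕ} (p : PrimRec g F) where

  abstract
    diagᵖ : PrimRec g (diag ∘ F)
    diagᵖ = recᵖ (const 0)
      (ifZeroᵖ (triᵖ (sucᵖ (var 1F)) ∸ᵖ sucᵖ (var 0F)) (sucᵖ (var 1F)) (var 1F)) p

    π₂ᵖ : PrimRec g (π₂ ∘ F)
    π₂ᵖ = p ∸ᵖ triᵖ diagᵖ

    π₁ᵖ : PrimRec g (π₁ ∘ F)
    π₁ᵖ = diagᵖ ∸ᵖ π₂ᵖ

abstract
  entryᵖ : ∀ {g n} {F G : Vec ℕ n → ℕ} → PrimRec g F → PrimRec g G →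
           PrimRec g (λ xs → entry (F xs) (G xs))
  entryᵖ p q = π₁ᵖ (recᵖ p (π₂ᵖ (var 1F)) q)

  pairᵖ : ∀ {g n} {F G : Vec ℕ n → ℕ} → PrimRec g F → PrimRec g G →
           PrimRec g (λ xs → ⟨ F xs , G xs ⟩)
  pairᵖ p q = triᵖ (p +ᵖ q) +ᵖ q

-- Primitive recursive predicates

-- As in Σ3Graph, truth is represented by 0.

record Decᵖ (g : ℕ → ℕ) {n} (P : Vec ℕ n → Set) : Set where
  constructor decᵖ
  field
    {char} : Vec ℕ n → ℕ
    prim   : PrimRec g char
    sound  : ∀ xs → P xs ⟺ char xs ≡ 0

abstract
  decide : ∀ {g n} {P : Vec ℕ n → Set} → Decᵖ g P → ∀ xs → Dec (P xs)
  decide (decᵖ {c} _ s) xs with c xs ≟ 0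
  ... | yes e = yes (proj₂ (s xs) e)
  ... | no ne = no (ne ∘ proj₁ (s xs))

module _ {g : ℕ → ℕ} where

  abstract
    equivᵈ : ∀ {n} {P Q : Vec ℕ n → Set} → (∀ xs → P xs ⟺ Q xs) → Decᵖ g P → Decᵖ g Q
    equivᵈ e (decᵖ p s) = decᵖ p λ xs → proj₁ (s xs) ∘ proj₂ (e xs) , proj₁ (e xs) ∘ proj₂ (s xs)

    subᵈ : ∀ {m n} {P : Vec ℕ m → Set} {G : Vec ℕ n → Vec ℕ m} →
           Decᵖ g P → PrimRecs g G → Decᵖ g (P ∘ G)
    subᵈ {G = G} (decᵖ p s) q = decᵖ (sub p q) λ xs → s (G xs)

  module _ {n} {F G : Vec ℕ n → ℕ} (p : PrimRec g F) (q : PrimRec g G) where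

    abstract
      _≤ᵈ_ : Decᵖ g (λ xs → F xs ≤ G xs)
      _≤ᵈ_ = decᵖ (p ∸ᵖ q) λ xs → m≤n⇒m∸n≡0 , m∸n≡0⇒m≤n

      _<ᵈ_ : Decᵖ g (λ xs → F xs < G xs)
      _<ᵈ_ = decᵖ (sucᵖ p ∸ᵖ q) λ xs → m≤n⇒m∸n≡0 , m∸n≡0⇒m≤n

  module _ {n} {P Q : Vec ℕ n → Set} where

    abstract
      infixr 2 _×ᵈ_
      infixr 1 _⊎ᵈ_

      _×ᵈ_ : Decᵖ g P → Decᵖ g Q → Decᵖ g (λ xs → P xs × Q xs)
      decᵖ {c} p s ×ᵈ decᵖ {d} q t = decᵖ (p +ᵖ q) λ xs →
        (λ (x , y) → cong₂ _+_ (proj₁ (s xs) x) (proj₁ (t xs) y)) ,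
        (λ e → proj₂ (s xs) (m+n≡0⇒m≡0 (c xs) e) , proj₂ (t xs) (m+n≡0⇒n≡0 (c xs) e))

      _⊎ᵈ_ : Decᵖ g P → Decᵖ g Q → Decᵖ g (λ xs → P xs ⊎ Q xs)
      decᵖ {c} p s ⊎ᵈ decᵖ {d} q t = decᵖ (p *ᵖ q) λ xs → to' xs , from' xs
        where
        to' : ∀ xs → P xs ⊎ Q xs → c xs * d xs ≡ 0
        to' xs (inj₁ x) rewrite proj₁ (s xs) x = refl
        to' xs (inj₂ y) rewrite proj₁ (t xs) y = *-zeroʳ (c xs)
        from' : ∀ xs → c xs * d xs ≡ 0 → P xs ⊎ Q xs
        from' xs e with m*n≡0⇒m≡0∨n≡0 (c xs) e
        ... | inj₁ x = inj₁ (proj₂ (s xs) x)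
        ... | inj₂ y = inj₂ (proj₂ (t xs) y)

  abstract
    ¬ᵈ_ : ∀ {n} {P : Vec ℕ n → Set} → Decᵖ g P → Decᵖ g (λ xs → ¬ P xs)
    ¬ᵈ_ {P = P} (decᵖ {c} p s) = decᵖ (const 1 ∸ᵖ p) λ xs → to' xs , from' xs
      where
      to' : ∀ xs → ¬ P xs → 1 ∸ c xs ≡ 0
      to' xs np with c xs | proj₂ (s xs)
      ... | zero  | f = ⊥-elim (np (f refl))
      ... | suc k | f = 0∸n≡0 k
      from' : ∀ xs → 1 ∸ c xs ≡ 0 → ¬ P xs
      from' xs e x rewrite proj₁ (s xs) x with () ← e

    infixr 0 _→ᵈ_
    _→ᵈ_ : ∀ {n} {P Q : Vec ℕ n → Set} → Decᵖ g P → Decᵖ g Q → Decᵖ g (λ xs → P xs → Q xs)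
    _→ᵈ_ {P = P} {Q} d e = equivᵈ (λ xs → (λ { (inj₁ np) x → ⊥-elim (np x) ; (inj₂ y) _ → y }) , from' xs) (¬ᵈ d ⊎ᵈ e)
      where
      from' : ∀ xs → (P xs → Q xs) → ¬ P xs ⊎ Q xs
      from' xs f with decide d xs
      ... | yes x = inj₂ (f x)
      ... | no np = inj₁ np

    _≡ᵈ_ : ∀ {n} {F G : Vec ℕ n → ℕ} → PrimRec g F → PrimRec g G → Decᵖ g (λ xs → F xs ≡ G xs)
    p ≡ᵈ q = equivᵈ (λ xs → (λ (a , b) → ≤-antisym a b) , (λ e → ≤-reflexive e , ≤-reflexive (sym e)))
      ((p ≤ᵈ q) ×ᵈ (q ≤ᵈ p))

    ∃≤ᵈ : ∀ {n} {P : Vec ℕ (suc n) → Set} {F : Vec ℕ n → ℕ} → Decᵖ g P → PrimRec g F →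
          Decᵖ g (λ xs → ∃ λ c → c ≤ F xs × P (c ∷ xs))
    ∃≤ᵈ {n} {P} {F} (decᵖ {χ} p s) q =
      -- Truth is 0, so a product of characteristic values vanishes iff one of the instances holds.
      decᵖ {char = λ xs → prod xs (suc (F xs))}
        (recᵖ (const 1) (sub p (var 0F ∷ᵖ tailᵖ (tailᵖ idᵖ)) *ᵖ var 1F) (sucᵖ q))
        λ xs → to' xs , from' xs (F xs)
      where
      prod : ∀ (xs : Vec ℕ n) → ℕ → ℕ
      prod xs = natRec 1 (λ k r → χ (k ∷ xs) * r)
      zero-factor : ∀ (xs : Vec ℕ n) m c → c ≤ m → χ (c ∷ xs) ≡ 0 → prod xs (suc m) ≡ 0
      zero-factor xs n c c≤n e with c ≟ n
      ... | yes refl = cong (_* prod xs n) e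
      zero-factor xs zero c c≤n e    | no ne = ⊥-elim (ne (n≤0⇒n≡0 c≤n))
      zero-factor xs (suc n) c c≤n e | no ne
        rewrite zero-factor xs n c (≤-pred (≤∧≢⇒< c≤n ne)) e = *-zeroʳ (χ (suc n ∷ xs))
      to' : ∀ (xs : Vec ℕ n) → (∃ λ c → c ≤ F xs × P (c ∷ xs)) → prod xs (suc (F xs)) ≡ 0
      to' xs (c , c≤ , x) = zero-factor xs (F xs) c c≤ (proj₁ (s _) x)
      from' : ∀ (xs : Vec ℕ n) m → prod xs (suc m) ≡ 0 → ∃ λ c → c ≤ m × P (c ∷ xs)
      from' xs n e with m*n≡0⇒m≡0∨n≡0 (χ (n ∷ xs)) e
      ... | inj₁ z = n , ≤-refl , proj₂ (s _) z
      from' xs zero e    | inj₂ ()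
      from' xs (suc n) e | inj₂ z with from' xs n z
      ... | c , c≤ , x = c , m≤n⇒m≤1+n c≤ , x

zero-oracle : ℕ → ℕ
zero-oracle _ = 0

abstract
  punctual : {_<_ : ℕ → ℕ → Set} → Decᵖ zero-oracle {2} (λ xs → lookup xs 0F < lookup xs 1F) →
             Σ Punctual λ A → ∀ x y → Rel A x y ⟺ x < y
  punctual {_<_} (decᵖ {c} p s) = record { rel = PrimRec.term q } , λ x y →
      (λ e → proj₂ (s _) (from' (x ∷ y ∷ []) (trans (sym (PrimRec.correct q _)) e))) ,
      (λ lt → trans (PrimRec.correct q _) (cong (1 ∸_) (proj₁ (s (x ∷ y ∷ [])) lt)))
    where
    q : PrimRec zero-oracle (λ xs → 1 ∸ c xs)
    -- `Rel` represents truth by 1, `Decᵖ` by 0.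
    q = const 1 ∸ᵖ p
    from' : ∀ xs → 1 ∸ c xs ≡ 1 → c xs ≡ 0
    from' xs e with c xs
    ... | zero  = refl
    ... | suc k with () ← trans (sym e) (0∸n≡0 k)

abstract
  Relᵈ : ∀ {n} {F G : Vec ℕ n → ℕ} (A : Punctual) → PrimRec zero-oracle F → PrimRec zero-oracle G →
         Decᵖ zero-oracle (λ xs → Rel A (F xs) (G xs))
  Relᵈ A p q = sub (primRec (Punctual.rel A) λ _ → refl) (p ∷ᵖ q ∷ᵖ []ᵖ) ≡ᵈ const 1

-- Finite bounds, the pigeonhole principle and classical logic

maximum : ∀ (h : ℕ → ℕ) n → ∃ λ b → ∀ i → i < n → h i < b
maximum h zero = 0 , λ _ ()
maximum h (suc n) with maximum h n
... | b , p = suc (h n) ⊔ b , bound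
  where
  bound : ∀ i → i < suc n → h i < suc (h n) ⊔ b
  bound i i<1+n with i ≟ n
  ... | yes refl = m≤m⊔n (suc (h n)) b
  ... | no i≢n = <-≤-trans (p i (≤∧≢⇒< (≤-pred i<1+n) i≢n)) (m≤n⊔m (suc (h n)) b)

choose : ∀ {P : ℕ → ℕ → Set} n → (∀ i → i < n → ∃ (P i)) → ∃ λ (h : ℕ → ℕ) → ∀ i → i < n → P i (h i)
choose {P} n f = (λ i → pick i (i <? n)) , λ i lt → correct i (i <? n) lt
  where
  pick : ∀ i → Dec (i < n) → ℕ
  pick i (yes lt) = proj₁ (f i lt)
  pick i (no _)   = 0
  correct : ∀ i d → i < n → P i (pick i d)
  correct i (yes lt) _ = proj₂ (f i lt)
  correct i (no nlt) lt = ⊥-elim (nlt lt)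

uniformBound : ∀ {P : ℕ → ℕ → Set} n → (∀ {i b c} → b ≤ c → P i b → P i c) →
               (∀ i → i < n → ∃ (P i)) → ∃ λ b → ∀ i → i < n → P i b
uniformBound {P} n mono f with choose {P} n f
... | h , p with maximum h n
... | b , q = b , λ i lt → mono (<⇒≤ (q i lt)) (p i lt)

-- Otherwise `h` would restrict to an injection of b + 1 elements into b.
injective⇒unbounded : ∀ (h : ℕ → ℕ) → (∀ {i j} → h i ≡ h j → i ≡ j) → ∀ b → ∃ λ n → b ≤ h n
injective⇒unbounded h inj b with maximum-or b
  where
  maximum-or : ∀ n → (∃ λ i → b ≤ h i) ⊎ (∀ i → i ≤ n → h i < b)
  maximum-or n with anyUpTo? (λ i → b ≤? h i) (suc n)
  ... | yes (i , _ , p) = inj₁ (i , p)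
  ... | no np = inj₂ λ i i≤n → ≰⇒> λ le → np (i , s≤s i≤n , le)
... | inj₁ p = p
... | inj₂ p = ⊥-elim (<-irrefl refl (injective⇒≤ {suc b} {b} {f} f-inj))
  where
  f = λ i → fromℕ< (p (toℕ i) (≤-pred (toℕ<n i)))
  f-inj : ∀ {i j} → f i ≡ f j → i ≡ j
  f-inj e = toℕ-injective (inj (fromℕ<-injective _ _ _ _ e))

module Classical (em : ExcludedMiddle 0ℓ) where

  LeastBelow : (ℕ → Set) → ℕ → Set
  LeastBelow P n = ∃ λ m → P m × m ≤ n × (∀ i → i < m → ¬ P i)

  least : ∀ (P : ℕ → Set) {n} → P n → LeastBelow P n
  least P {n} = <-rec (λ n → P n → LeastBelow P n) step n
    where
    step : ∀ n → (∀ {i} → i < n → P i → LeastBelow P i) → P n → LeastBelow P n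
    step n rec p with em {∃ λ i → i < n × P i}
    ... | no none = n , p , ≤-refl , λ i lt q → none (i , lt , q)
    ... | yes (i , lt , q) with rec lt q
    ...   | m , r , le , min = m , r , ≤-trans le (<⇒≤ lt) , min

  byContradiction : ∀ {P : Set} → ¬ ¬ P → P
  byContradiction {P} nnp with em {P}
  ... | yes p = p
  ... | no np = ⊥-elim (nnp np)

  ¬∀⇒∃¬ : ∀ {P : ℕ → Set} → ¬ (∀ n → P n) → ∃ λ n → ¬ P n
  ¬∀⇒∃¬ nall = byContradiction λ ne → nall λ n → byContradiction λ np → ne (n , np)

-- Dense orders without endpoints

-- Incomparable points need not be equal: asymmetry and cotransitivity give a strict weak order, so
-- that `≪` qualifies, whose incomparability classes are the blocks.
record DenseOrder {X : Set} (_⊏_ : X → X → Set) : Set where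
  field
    asym    : ∀ {x y} → x ⊏ y → ¬ y ⊏ x
    cotrans : ∀ {x y} z → x ⊏ y → x ⊏ z ⊎ z ⊏ y
    dense   : ∀ {x y} → x ⊏ y → ∃ λ z → x ⊏ z × z ⊏ y
    upper   : ∀ x → ∃ λ y → x ⊏ y
    lower   : ∀ x → ∃ λ y → y ⊏ x

  irrefl : ∀ {x} → ¬ x ⊏ x
  irrefl p = asym p p

  trans⊏ : ∀ {x y z} → x ⊏ y → y ⊏ z → x ⊏ z
  trans⊏ {z = z} p q with cotrans z p
  ... | inj₁ r = r
  ... | inj₂ r = ⊥-elim (asym q r)

  ⊏-⊑-trans : ∀ {x y z} → x ⊏ y → ¬ z ⊏ y → x ⊏ z
  ⊏-⊑-trans {z = z} p q with cotrans z p
  ... | inj₁ r = r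
  ... | inj₂ r = ⊥-elim (q r)

  ⊑-⊏-trans : ∀ {x y z} → ¬ y ⊏ x → y ⊏ z → x ⊏ z
  ⊑-⊏-trans {x} q p with cotrans x p
  ... | inj₁ r = ⊥-elim (q r)
  ... | inj₂ r = r

converse : ∀ {X} {_⊏_ : X → X → Set} → DenseOrder _⊏_ → DenseOrder (λ x y → y ⊏ x)
converse D = record
  { asym    = asym
  ; cotrans = λ z p → Sum.swap (cotrans z p)
  ; dense   = λ p → let z , a , b = dense p in z , b , a
  ; upper   = lower
  ; lower   = upper
  }
  where open DenseOrder D

module Separation (em : ExcludedMiddle 0ℓ) where

  upperBound : ∀ {X} {_⊏_ : X → X → Set} → DenseOrder _⊏_ → ∀ p (v : ℕ → X) n →
               ∃ λ u → p ⊏ u × (∀ t → t < n → v t ⊏ u)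
  upperBound D p v zero = let u , q = DenseOrder.upper D p in u , q , λ _ ()
  upperBound {_⊏_ = _⊏_} D p v (suc n) with upperBound D p v n
  ... | u , pu , b with em {v n ⊏ u}
  ...   | yes q = u , pu , λ t lt → extend t lt
    where
    extend : ∀ t → t < suc n → v t ⊏ u
    extend t lt with t ≟ n
    ... | yes refl = q
    ... | no ne = b t (≤∧≢⇒< (≤-pred lt) ne)
  ...   | no nq with DenseOrder.upper D (v n)
  ...     | u' , r = u' , lift pu , extend
    where
    open DenseOrder D
    lift : ∀ {x} → x ⊏ u → x ⊏ u'
    lift l = trans⊏ (⊏-⊑-trans l nq) r
    extend : ∀ t → t < suc n → v t ⊏ u'
    extend t lt with t ≟ n
    ... | yes refl = r
    ... | no ne = lift (b t (≤∧≢⇒< (≤-pred lt) ne))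

  module _ {X} {_⊏_ : X → X → Set} (D : DenseOrder _⊏_) where
    open DenseOrder D

    -- The interval (l , u) shrinks as the points v (n-1), …, v 0 are taken into account.
    separate-within : ∀ (v : ℕ → X) (Lo Hi : ℕ → Set) n l u → l ⊏ u →
      (∀ t → t < n → Lo t → v t ⊏ u) → (∀ t → t < n → Hi t → l ⊏ v t) →
      (∀ t t' → Lo t → Hi t' → v t ⊏ v t') →
      ∃ λ r → l ⊏ r × r ⊏ u × (∀ t → t < n → (Lo t → v t ⊏ r) × (Hi t → r ⊏ v t))
    separate-within v Lo Hi zero l u l⊏u _ _ _ =
      let r , a , b = dense l⊏u in r , a , b , λ _ ()
    separate-within v Lo Hi (suc n) l u l⊏u lo hi lohi = finish
      where
      -- The greater of `l` and `v n` if `v n` has to lie below the cut, otherwise `l`; its origin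
      -- is recorded for the case analyses that follow.
      l' : ∃ λ l' → (l' ≡ l ⊎ Lo n × l' ≡ v n) × ¬ l' ⊏ l × (Lo n → ¬ l' ⊏ v n)
      l' with em {Lo n × l ⊏ v n}
      ... | yes (a , b) = v n , inj₂ (a , refl) , asym b , λ _ → irrefl
      ... | no nb = l , inj₁ refl , irrefl , λ a b → nb (a , b)
      u' : ∃ λ u' → (u' ≡ u ⊎ Hi n × u' ≡ v n) × ¬ u ⊏ u' × (Hi n → ¬ v n ⊏ u')
      u' with em {Hi n × v n ⊏ u}
      ... | yes (a , b) = v n , inj₂ (a , refl) , asym b , λ _ → irrefl
      ... | no nb = u , inj₁ refl , irrefl , λ a b → nb (a , b)
      L = proj₁ l'
      U = proj₁ u'
      L⊏ : ∀ t → t < suc n → Hi t → L ⊏ v t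
      L⊏ t lt h with proj₁ (proj₂ l')
      ... | inj₁ e       = subst (_⊏ v t) (sym e) (hi t lt h)
      ... | inj₂ (a , e) = subst (_⊏ v t) (sym e) (lohi n t a h)
      ⊏U : ∀ t → t < suc n → Lo t → v t ⊏ U
      ⊏U t lt h with proj₁ (proj₂ u')
      ... | inj₁ e       = subst (v t ⊏_) (sym e) (lo t lt h)
      ... | inj₂ (a , e) = subst (v t ⊏_) (sym e) (lohi t n h a)
      L⊏U : L ⊏ U
      L⊏U with proj₁ (proj₂ u')
      ... | inj₂ (a , e) = subst (L ⊏_) (sym e) (L⊏ n ≤-refl a)
      ... | inj₁ e with proj₁ (proj₂ l')
      ...   | inj₁ e'       = subst₂ _⊏_ (sym e') (sym e) l⊏u
      ...   | inj₂ (a , e') = subst₂ _⊏_ (sym e') (sym e) (lo n ≤-refl a)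
      finish : _
      finish with separate-within v Lo Hi n L U L⊏U (λ t lt → ⊏U t (m≤n⇒m≤1+n lt))
                    (λ t lt → L⊏ t (m≤n⇒m≤1+n lt)) lohi
      ... | r , a , b , c = r , ⊑-⊏-trans (proj₁ (proj₂ (proj₂ l'))) a ,
                            ⊏-⊑-trans b (proj₁ (proj₂ (proj₂ u'))) , extend
        where
        extend : ∀ t → t < suc n → (Lo t → v t ⊏ r) × (Hi t → r ⊏ v t)
        extend t lt with t ≟ n
        ... | yes refl = (λ h → ⊑-⊏-trans (proj₂ (proj₂ (proj₂ l')) h) a) ,
                         (λ h → ⊏-⊑-trans b (proj₂ (proj₂ (proj₂ u')) h))
        ... | no ne = c t (≤∧≢⇒< (≤-pred lt) ne)

    separate : X → ∀ (v : ℕ → X) (Lo Hi : ℕ → Set) n → (∀ t t' → Lo t → Hi t' → v t ⊏ v t') →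
      ∃ λ r → ∀ t → t < n → (Lo t → v t ⊏ r) × (Hi t → r ⊏ v t)
    separate p v Lo Hi n lohi =
      let u , pu , above = upperBound D p v n
          l , lp , below = upperBound (converse D) p v n
          r , _ , _ , fits = separate-within v Lo Hi n l u (trans⊏ lp pu)
                               (λ t lt _ → above t lt) (λ t lt _ → below t lt) lohi
      in r , fits

opaque
  ℚ-denseOrder : DenseOrder ℚ._<_
  ℚ-denseOrder = record
    { asym    = ℚ.<-asym
    ; cotrans = ct
    ; dense   = ℚ.<-dense
    ; upper   = λ x → x ℚ.+ ℚ.1ℚ , subst (ℚ._< x ℚ.+ ℚ.1ℚ) (ℚ.+-identityʳ x) (ℚ.+-monoʳ-< x (ℚ.positive⁻¹ ℚ.1ℚ))
    ; lower   = λ x → x ℚ.- ℚ.1ℚ , subst (x ℚ.- ℚ.1ℚ ℚ.<_) (ℚ.+-identityʳ x) (ℚ.+-monoʳ-< x (ℚ.negative⁻¹ (ℚ.- ℚ.1ℚ)))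
    }
    where
    ct : ∀ {x y} z → x ℚ.< y → x ℚ.< z ⊎ z ℚ.< y
    ct {x} {y} z p with ℚ.<-cmp x z
    ... | tri< a _ _    = inj₁ a
    ... | tri≈ _ refl _ = inj₂ p
    ... | tri> _ _ a    = inj₂ (ℚ.<-trans a p)

-- Cantor's theorem by the "forth" construction alone: taking the least fitting value at each
-- step already makes the embedding surjective.
module Cantor (em : ExcludedMiddle 0ℓ) (val : ℕ → ℚ) (val-surjective : ∀ r → ∃ λ e → val e ≡ r)
              {_≪_ : ℕ → ℕ → Set} (D : DenseOrder _≪_) where
  open Classical em
  open Separation em
  open DenseOrder D

  -- `h` and `r` give codes of rationals: the least fitting value is the one with the least code.
  Fits : (ℕ → ℕ) → ℕ → ℕ → ℕ → Set
  Fits h s r t = (t ≪ s ⟺ val (h t) ℚ.< val r) × (s ≪ t ⟺ val r ℚ.< val (h t))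

  FitsBelow : (ℕ → ℕ) → ℕ → ℕ → Set
  FitsBelow h s r = ∀ t → t < s → Fits h s r t

  Step : (ℕ → ℕ) → ℕ → Set
  Step h s = FitsBelow h s (h s) × (∀ r → r < h s → ¬ FitsBelow h s r)

  Fits-cong : ∀ {h h' s r t} → h t ≡ h' t → Fits h s r t → Fits h' s r t
  Fits-cong {s = s} {r} {t} e = subst (λ w → (t ≪ s ⟺ val w ℚ.< val r) × (s ≪ t ⟺ val r ℚ.< val w)) e

  FitsBelow-cong : ∀ {h h' s r} → (∀ t → t < s → h t ≡ h' t) → FitsBelow h s r → FitsBelow h' s r
  FitsBelow-cong {h} {h'} e f t lt = Fits-cong {h} {h'} (e t lt) (f t lt)

  step-unique : ∀ {h h'} n → (∀ i → i ≤ n → Step h i) → (∀ i → i ≤ n → Step h' i) →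
                ∀ i → i ≤ n → h i ≡ h' i
  step-unique {h} {h'} n sh sh' i = <-rec (λ i → i ≤ n → h i ≡ h' i) go i
    where
    go : ∀ i → (∀ {t} → t < i → t ≤ n → h t ≡ h' t) → i ≤ n → h i ≡ h' i
    go i rec i≤n with agree ← (λ t lt → rec {t} lt (≤-trans (<⇒≤ lt) i≤n)) = ≤-antisym
      (≮⇒≥ λ lt → proj₂ (sh i i≤n) _ lt
        (FitsBelow-cong {h'} {h} (λ t l → sym (agree t l)) (proj₁ (sh' i i≤n))))
      (≮⇒≥ λ lt → proj₂ (sh' i i≤n) _ lt (FitsBelow-cong {h} {h'} agree (proj₁ (sh i i≤n))))

  pick : (ℕ → ℕ) → ℕ → ℕ
  pick h s with em {∃ (FitsBelow h s)}
  ... | yes (r , p) = proj₁ (least (FitsBelow h s) p)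
  -- A default that `fitting-exists` excludes along `q`.
  ... | no _        = 0

  pick-correct : ∀ h s → ∃ (FitsBelow h s) →
                 FitsBelow h s (pick h s) × (∀ r → r < pick h s → ¬ FitsBelow h s r)
  pick-correct h s w with em {∃ (FitsBelow h s)}
  ... | yes (r , p) = let _ , a , _ , b = least (FitsBelow h s) p in a , b
  ... | no none     = ⊥-elim (none w)

  -- `build s` tabulates the first `s` choices, which turns the course-of-values recursion into a
  -- structural one.
  build : ℕ → ℕ → ℕ
  build zero    t = 0
  build (suc s) t with t ≟ s
  ... | yes _ = pick (build s) s
  ... | no  _ = build s t

  q : ℕ → ℕ
  q s = pick (build s) s

  build≡q : ∀ s t → t < s → build s t ≡ q t
  build≡q (suc s) t lt with t ≟ s
  ... | yes refl = refl
  ... | no ne    = build≡q s t (≤∧≢⇒< (≤-pred lt) ne)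

  q-step' : ∀ s → ∃ (FitsBelow q s) → Step q s
  q-step' s (r , f) with pick-correct (build s) s (r , FitsBelow-cong {q} {build s} (λ t lt → sym (build≡q s t lt)) f)
  ... | a , b = FitsBelow-cong {build s} {q} (build≡q s) a ,
                λ r lt f → b r lt (FitsBelow-cong {q} {build s} (λ t lt → sym (build≡q s t lt)) f)

  Embeds : ℕ → ℕ → Set
  Embeds s t = s ≪ t ⟺ val (q s) ℚ.< val (q t)

  embeds-below : ∀ n → (∀ {i} → i < n → Step q i) → ∀ s t → s < n → t < n → Embeds s t
  embeds-below n step s t s<n t<n with <-cmp s t
  ... | tri< lt _ _   = proj₁ (proj₁ (step t<n) s lt)
  ... | tri≈ _ refl _ = (λ p → ⊥-elim (irrefl p)) , λ p → ⊥-elim (ℚ.<-irrefl refl p)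
  ... | tri> _ _ lt   = proj₂ (proj₁ (step s<n) t lt)

  -- If an earlier `t` lies in the block of `s`, its value serves again. Otherwise every earlier
  -- point is comparable with `s`, and density of ℚ separates the values of the points below from
  -- those above.
  fitting-exists : ∀ s → (∀ {i} → i < s → Step q i) → ∃ (FitsBelow q s)
  fitting-exists s step with em {∃ λ t → t < s × ¬ t ≪ s × ¬ s ≪ t}
  ... | yes (t , t<s , a , b) = q t , λ t' t'<s →
      (let e = embeds-below s step t' t t'<s t<s in
         (λ p → proj₁ e (⊏-⊑-trans p a)) , λ p → ⊏-⊑-trans (proj₂ e p) b) ,
      (let e = embeds-below s step t t' t<s t'<s in
         (λ p → proj₁ e (⊑-⊏-trans b p)) , λ p → ⊑-⊏-trans a (proj₂ e p))
  ... | no none with separate ℚ-denseOrder ℚ.0ℚ (val ∘ q) (λ t → t < s × t ≪ s) (λ t → t < s × s ≪ t) s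
                       (λ t t' (a , b) (c , d) → proj₁ (embeds-below s step t t' a c) (trans⊏ b d))
  ...   | r , sep with val-surjective r
  ...     | e , refl = e , fits
    where
    fits : FitsBelow q s e
    fits t t<s with em {t ≪ s} | em {s ≪ t}
    ... | yes p | _     = ((λ _ → lt) , (λ _ → p)) , ((λ p' → ⊥-elim (asym p p')) , λ gt → ⊥-elim (ℚ.<-asym lt gt))
      where lt = proj₁ (sep t t<s) (t<s , p)
    ... | no _  | yes p = ((λ p' → ⊥-elim (asym p p')) , λ lt → ⊥-elim (ℚ.<-asym lt gt)) , ((λ _ → gt) , (λ _ → p))
      where gt = proj₂ (sep t t<s) (t<s , p)
    ... | no a  | no b  = ⊥-elim (none (t , t<s , a , b))

  q-step : ∀ s → Step q s
  q-step s = <-rec (Step q) (λ s rec → q-step' s (fitting-exists s rec)) s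

  q-embeds : ∀ s t → Embeds s t
  q-embeds s t = embeds-below (suc (s ⊔ t)) (λ _ → q-step _) s t (s≤s (m≤m⊔n s t)) (s≤s (m≤n⊔m s t))

  -- By `step-unique` every coded run that obeys `Step` agrees with `q`, so the existence of one run
  -- defines `q`.
  q-characterised : ∀ x r → q x ≡ r ⟺ (∃ λ s → entry s x ≡ r × (∀ i → i < suc x → Step (entry s) i))
  q-characterised x r = to' , from'
    where
    Step-cong : ∀ {h h'} i → (∀ t → t ≤ i → h t ≡ h' t) → Step h i → Step h' i
    Step-cong {h} {h'} i e (a , b) =
      subst (FitsBelow h' i) (e i ≤-refl) (FitsBelow-cong {h} {h'} (λ t lt → e t (<⇒≤ lt)) a) ,
      λ r lt f → b r (subst (r <_) (sym (e i ≤-refl)) lt)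
                     (FitsBelow-cong {h'} {h} (λ t lt → sym (e t (<⇒≤ lt))) f)
    to' : _
    to' e with encode q (suc x)
    ... | s , p = s , trans (p x ≤-refl) e , λ i lt →
      Step-cong i (λ t le → sym (p t (≤-<-trans le lt))) (q-step i)
    from' : _
    from' (s , e , st) =
      trans (step-unique x (λ i _ → q-step i) (λ i le → st i (s≤s le)) x ≤-refl) e

  private module ℚD = DenseOrder ℚ-denseOrder

  Gap : ℕ → ℕ → ℕ → Set
  Gap e s₀ s = ∀ t → t < s₀ → (val (q t) ℚ.< val e → t ≪ s) × (val e ℚ.< val (q t) → s ≪ t)

  -- Why the embedding is onto. Suppose the first `s₀` points have used all values with codes below
  -- `e`, but not `val e`. The first `s` that realises the cut of `val e` among them receives `e`:
  -- every `t < s` is on the wrong side of one of these points, which puts `t` on the correct side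
  -- of `s`, so `e` fits; a smaller code would repeat the value of a point that is comparable with
  -- `s`.
  module _ (e s₀ s : ℕ)
    (covered : ∀ e' → e' < e → ∃ λ t → t < s₀ × val (q t) ≡ val e')
    (new : ¬ (∃ λ t → t < s₀ × val (q t) ≡ val e))
    (inGap : Gap e s₀ s) (firstGap : ∀ i → i < s → ¬ Gap e s₀ i) where

    s₀≤s : s₀ ≤ s
    s₀≤s = ≮⇒≥ λ lt → case ℚ.<-cmp (val (q s)) (val e) of λ where
      (tri< a _ _) → irrefl (proj₁ (inGap s lt) a)
      (tri≈ _ a _) → new (s , lt , a)
      (tri> _ _ a) → irrefl (proj₂ (inGap s lt) a)
    below : ∀ {t} → val (q t) ℚ.< val e → t ≪ s → Fits q s e t
    below lt p = ((λ _ → lt) , (λ _ → p)) ,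
                 ((λ p' → ⊥-elim (asym p p')) , λ gt → ⊥-elim (ℚ.<-asym lt gt))
    above : ∀ {t} → val e ℚ.< val (q t) → s ≪ t → Fits q s e t
    above gt p = ((λ p' → ⊥-elim (asym p p')) , λ lt → ⊥-elim (ℚ.<-asym lt gt)) ,
                 ((λ _ → gt) , (λ _ → p))
    e-fits : FitsBelow q s e
    e-fits t t<s with em {Fits q s e t}
    ... | yes f = f
    ... | no nf = ⊥-elim (firstGap t t<s λ t' t'<s₀ →
      (λ a → byContradiction λ na → nf
         (below (ℚD.⊑-⊏-trans (λ l → na (proj₂ (q-embeds t' t) l)) a)
                (⊑-⊏-trans na (proj₁ (inGap t' t'<s₀) a)))) ,
      (λ a → byContradiction λ na → nf
         (above (ℚD.⊏-⊑-trans a (λ l → na (proj₂ (q-embeds t t') l)))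
                (⊏-⊑-trans (proj₂ (inGap t' t'<s₀) a) na))))
    first-gap-hit : q s ≡ e
    first-gap-hit = ≤-antisym (≮⇒≥ λ lt → proj₂ (q-step s) e lt e-fits) (≮⇒≥ no-smaller)
      where
      no-smaller : ¬ q s < e
      no-smaller lt with covered (q s) lt
      ... | t , t<s₀ , eq with proj₁ (q-step s) t (<-≤-trans t<s₀ s₀≤s) | ℚ.<-cmp (val (q t)) (val e)
      ...   | (f , _) , _ | tri< a _ _ = ℚ.<-irrefl eq (f (proj₁ (inGap t t<s₀) a))
      ...   | _           | tri≈ _ a _ = new (t , t<s₀ , a)
      ...   | _ , (f , _) | tri> _ _ a = ℚ.<-irrefl (sym eq) (f (proj₂ (inGap t t<s₀) a))

  -- Strong induction on the code. Density of `≪` provides some point in the gap, and the least such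
  -- number is the `s` of `first-gap-hit`.
  q-hits : ∀ e → ∃ λ s → val (q s) ≡ val e
  q-hits e = <-rec (λ e → ∃ λ s → val (q s) ≡ val e) go e
    where
    go : ∀ e → (∀ {e'} → e' < e → ∃ λ s → val (q s) ≡ val e') → ∃ λ s → val (q s) ≡ val e
    go e rec with uniformBound {λ e' b → ∃ λ t → t < b × val (q t) ≡ val e'} e
                    (λ b≤c (t , lt , eq) → t , <-≤-trans lt b≤c , eq)
                    (λ e' lt → let s , eq = rec lt in suc s , s , ≤-refl , eq)
    ... | s₀ , covered with em {∃ λ t → t < s₀ × val (q t) ≡ val e}
    ...   | yes (t , _ , eq) = t , eq
    ...   | no new with separate D 0 (λ t → t) (λ t → val (q t) ℚ.< val e) (λ t → val e ℚ.< val (q t))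
                          s₀ (λ t t' a b → proj₂ (q-embeds t t') (ℚ.<-trans a b))
    ...     | g , gap with least (Gap e s₀) gap
    ...       | s , inGap , _ , firstGap = s , cong val (first-gap-hit e s₀ s covered new inGap firstGap)

  q-surjective : ∀ r → ∃ λ s → val (q s) ≡ r
  q-surjective r with val-surjective r
  ... | e , refl = q-hits e

-- Orders of type ω*η described by their blocks

record StrictLinear {X : Set} (_⊏_ : X → X → Set) : Set where
  field
    irrefl⊏ : ∀ {x} → ¬ x ⊏ x
    trans⊏  : ∀ {x y z} → x ⊏ y → y ⊏ z → x ⊏ z
    compare : ∀ x y → x ⊏ y ⊎ x ≡ y ⊎ y ⊏ x

  asym⊏ : ∀ {x y} → x ⊏ y → ¬ y ⊏ x
  asym⊏ p q = irrefl⊏ (trans⊏ p q)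

  connected : ∀ {x y} → ¬ x ⊏ y → ¬ y ⊏ x → x ≡ y
  connected {x} {y} p q with compare x y
  ... | inj₁ r        = ⊥-elim (p r)
  ... | inj₂ (inj₁ e) = e
  ... | inj₂ (inj₂ r) = ⊥-elim (q r)

  cotrans⊏ : ∀ {x y} z → x ⊏ y → x ⊏ z ⊎ z ⊏ y
  cotrans⊏ {x} z p with compare x z
  ... | inj₁ q           = inj₁ q
  ... | inj₂ (inj₁ refl) = inj₂ p
  ... | inj₂ (inj₂ q)    = inj₂ (trans⊏ q p)

Unboundedly : (ℕ → Set) → Set
Unboundedly P = ∀ b → ∃ λ c → b ≤ c × P c

-- x ≪ y means that x < y lie in different blocks of the order.
record Blocks (_⊏_ : ℕ → ℕ → Set) : Set₁ where
  field
    linear    : StrictLinear _⊏_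
    _≪_       : ℕ → ℕ → Set
    ≪-dense   : DenseOrder _≪_
    ≪⇒⊏       : ∀ {x y} → x ≪ y → x ⊏ y
    -- With `unending` this gives each block type ω: finitely many predecessors, stated as a bound
    -- on them as numbers, and no last point.
    bounded   : ∀ x → ∃ λ b → ∀ z → z ⊏ x → ¬ z ≪ x → z < b
    unending  : ∀ x → ∃ λ y → x ⊏ y × ¬ x ≪ y

module BlockTheory (em : ExcludedMiddle 0ℓ) {_⊏_ : ℕ → ℕ → Set} (B : Blocks _⊏_) where
  open Blocks B public
  open StrictLinear linear public
  open DenseOrder ≪-dense public using (⊏-⊑-trans; ⊑-⊏-trans) renaming (cotrans to ≪-cotrans; irrefl to ≪-irrefl)
  open Classical em

  ≪-⊏̸-trans : ∀ {x y z} → x ≪ y → ¬ z ⊏ y → x ≪ z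
  ≪-⊏̸-trans p n = ⊏-⊑-trans p (n ∘ ≪⇒⊏)

  ⊏̸-≪-trans : ∀ {x y z} → ¬ y ⊏ x → y ≪ z → x ≪ z
  ⊏̸-≪-trans n p = ⊑-⊏-trans (n ∘ ≪⇒⊏) p

  minimal : ∀ (S : ℕ → Set) b y → S y → (∀ z → S z → z ⊏ y → z < b) →
            ∃ λ m → S m × ¬ y ⊏ m × (∀ z → S z → ¬ z ⊏ m)
  minimal S zero y sy bd = y , sy , irrefl⊏ , λ z sz lt → case bd z sz lt of λ ()
  minimal S (suc b) y sy bd with em {S b × b ⊏ y}
  ... | yes (sb , lt) with minimal S b b sb (λ z sz l →
                             ≤∧≢⇒< (≤-pred (bd z sz (trans⊏ l lt))) λ { refl → irrefl⊏ l })
  ...   | m , sm , nl , min = m , sm , (λ l → nl (trans⊏ lt l)) , min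
  minimal S (suc b) y sy bd | no nb =
    minimal S b y sy λ z sz l → ≤∧≢⇒< (≤-pred (bd z sz l)) λ { refl → nb (sz , l) }

  _∼_ : ℕ → ℕ → Set
  x ∼ y = ¬ x ≪ y × ¬ y ≪ x

  ∼-refl : ∀ {x} → x ∼ x
  ∼-refl = ≪-irrefl , ≪-irrefl

  ∼-sym : ∀ {x y} → x ∼ y → y ∼ x
  ∼-sym (a , b) = b , a

  ∼-trans : ∀ {x y z} → x ∼ y → y ∼ z → x ∼ z
  ∼-trans (a , b) (c , d) = (λ p → a (⊏-⊑-trans p c)) , (λ p → d (⊏-⊑-trans p b))

  opaque
    immediateSuccessor : ∀ x → ∃ λ y → x ⊏ y × (∀ z → x ⊏ z → ¬ z ⊏ y) × x ∼ y
    immediateSuccessor x with unending x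
    ... | y , x⊏y , n with bounded y
    ... | b , bd with minimal (x ⊏_) b y x⊏y
                        (λ z x⊏z z⊏y → bd z z⊏y λ z≪y → n (⊏̸-≪-trans (asym⊏ x⊏z) z≪y))
    ... | m , x⊏m , y⋢m , min = m , x⊏m , min , (λ p → n (≪-⊏̸-trans p y⋢m)) , λ p → asym⊏ x⊏m (≪⇒⊏ p)

    blockMinimum : ∀ x → ∃ λ m → m ∼ x × (∀ z → z ∼ x → ¬ z ⊏ m)
    blockMinimum x with bounded x
    ... | b , bd with minimal (_∼ x) b x ∼-refl (λ z z∼x z⊏x → bd z z⊏x (proj₁ z∼x))
    ... | m , m∼x , _ , min = m , m∼x , min

  next : ℕ → ℕ
  next x = proj₁ (immediateSuccessor x)

  first : ℕ → ℕ
  first x = proj₁ (blockMinimum x)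

  next-unique : ∀ {x y} → x ⊏ y → (∀ z → x ⊏ z → ¬ z ⊏ y) → y ≡ next x
  next-unique {x} {y} l n with immediateSuccessor x
  ... | m , l' , n' , _ = connected (n' y l) (n m l')

  first-unique : ∀ {x m} → m ∼ x → (∀ z → z ∼ x → ¬ z ⊏ m) → m ≡ first x
  first-unique {x} {m} m∼x min with blockMinimum x
  ... | m' , m'∼x , min' = connected (min' m m∼x) (min m' m'∼x)

  first-cong : ∀ {x y} → x ∼ y → first x ≡ first y
  first-cong {x} {y} x∼y with blockMinimum x
  ... | m , m∼x , min = first-unique (∼-trans m∼x x∼y) λ z z∼y → min z (∼-trans z∼y (∼-sym x∼y))

  enum : ℕ → ℕ → ℕ
  enum x zero    = first x
  enum x (suc n) = next (enum x n)

  enum-cong : ∀ {x y} → x ∼ y → ∀ n → enum x n ≡ enum y n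
  enum-cong p zero    = first-cong p
  enum-cong p (suc n) = cong next (enum-cong p n)

  enum∼ : ∀ x n → enum x n ∼ x
  enum∼ x zero    = proj₁ (proj₂ (blockMinimum x))
  enum∼ x (suc n) = ∼-trans (∼-sym (proj₂ (proj₂ (proj₂ (immediateSuccessor (enum x n)))))) (enum∼ x n)

  next-above : ∀ x → x ⊏ next x
  next-above x = proj₁ (proj₂ (immediateSuccessor x))

  enum-mono : ∀ x {m n} → m < n → enum x m ⊏ enum x n
  enum-mono x {m} {suc n} m<1+n with m≤n⇒m<n∨m≡n (≤-pred m<1+n)
  ... | inj₁ m<n  = trans⊏ (enum-mono x m<n) (next-above _)
  ... | inj₂ refl = next-above _

  enum-reflects : ∀ x {m n} → enum x m ⊏ enum x n → m < n
  enum-reflects x {m} {n} l with <-cmp m n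
  ... | tri< p _ _    = p
  ... | tri≈ _ refl _ = ⊥-elim (irrefl⊏ l)
  ... | tri> _ _ p    = ⊥-elim (asym⊏ l (enum-mono x p))

  enum-injective : ∀ x {m n} → enum x m ≡ enum x n → m ≡ n
  enum-injective x {m} {n} e with <-cmp m n
  ... | tri< p _ _ = ⊥-elim (irrefl⊏ (subst (_⊏ enum x n) e (enum-mono x p)))
  ... | tri≈ _ p _ = p
  ... | tri> _ _ p = ⊥-elim (irrefl⊏ (subst (enum x n ⊏_) e (enum-mono x p)))

  -- The enumeration is injective, so as numbers its values exceed the bound on the predecessors of
  -- `y` in its block, and some value is not below `y`. The first such value is `y`, because the
  -- value before it is still below.
  enum-surjective : ∀ y → ∃ λ n → enum y n ≡ y
  enum-surjective y with bounded y
  ... | b , bd with injective⇒unbounded (enum y) (enum-injective y) b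
  ... | n , b≤ with least (λ n → ¬ enum y n ⊏ y)
                     {n} (λ l → <-irrefl refl (<-≤-trans (bd _ l (proj₁ (enum∼ y n))) b≤))
  ... | zero  , nl , _ , _   = 0 , connected nl (proj₂ (proj₂ (blockMinimum y)) y ∼-refl)
  ... | suc m , nl , _ , min = suc m , connected nl between
    where
    between : ¬ y ⊏ enum y (suc m)
    between = proj₁ (proj₂ (proj₂ (immediateSuccessor (enum y m)))) y (byContradiction (min m ≤-refl))

  position : ℕ → ℕ
  position y = proj₁ (enum-surjective y)

  enum-position : ∀ y → enum y (position y) ≡ y
  enum-position y = proj₂ (enum-surjective y)

  position-enum : ∀ x n → position (enum x n) ≡ n
  position-enum x n = enum-injective x
    (trans (sym (enum-cong (enum∼ x n) (position (enum x n)))) (enum-position (enum x n)))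

  position-order : ∀ {x y} → x ∼ y → x ⊏ y ⟺ position x < position y
  position-order {x} {y} x∼y =
    (λ l → enum-reflects x (subst₂ _⊏_ (sym (enum-position x)) (sym y≡) l)) ,
    (λ l → subst₂ _⊏_ (enum-position x) y≡ (enum-mono x l))
    where
    y≡ : enum x (position y) ≡ y
    y≡ = trans (enum-cong x∼y (position y)) (enum-position y)

  Between : ℕ → ℕ → ℕ → Set
  Between x y z = x ⊏ z × z ⊏ y

  -- The ∀∃ form makes `≪` Π₂. Forwards, the rest of the block of `x` lies in between; backwards,
  -- the predecessors of `y` in its own block are bounded.
  ≪⟺unboundedly : ∀ x y → x ≪ y ⟺ Unboundedly (Between x y)
  ≪⟺unboundedly x y = to' , from'
    where
    to' : x ≪ y → Unboundedly (Between x y)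
    to' x≪y b with injective⇒unbounded (λ n → enum x (suc (position x) + n))
                   (λ e → +-cancelˡ-≡ (suc (position x)) _ _ (enum-injective x e)) b
    ... | n , b≤ = enum x k , b≤ ,
        subst (_⊏ enum x k) (enum-position x) (enum-mono x (s≤s (m≤m+n (position x) n))) ,
        ≪⇒⊏ (⊑-⊏-trans (proj₂ (enum∼ x k)) x≪y)
      where k = suc (position x) + n
    from' : Unboundedly (Between x y) → x ≪ y
    from' u = byContradiction λ n → let b , bd = bounded y
                                        c , b≤c , x⊏c , c⊏y = u b
      in <-irrefl refl (<-≤-trans (bd c c⊏y λ p → n (⊏̸-≪-trans (asym⊏ x⊏c) p)) b≤c)

  IsFirst : ℕ → Set
  IsFirst m = ∀ z → z ⊏ m → z ≪ m

  Covers : ℕ → ℕ → Set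
  Covers x y = x ⊏ y × (∀ z → ¬ Between x y z)

  position-first : ∀ {m} → IsFirst m → position m ≡ 0
  position-first {m} isF = trans (cong position m≡) (position-enum m 0)
    where
    m≡ : m ≡ first m
    m≡ = first-unique ∼-refl λ z z∼m z⊏m → proj₁ z∼m (isF z z⊏m)

  position-covers : ∀ {x y} → Covers x y → position y ≡ suc (position x)
  position-covers {x} {y} (l , n) = trans (cong position y≡) (position-enum x (suc (position x)))
    where
    y≡ : y ≡ enum x (suc (position x))
    y≡ = trans (next-unique l λ z a b → n z (a , b)) (cong next (sym (enum-position x)))

  first-isFirst : ∀ x → IsFirst (first x)
  first-isFirst x z l = byContradiction λ n → proj₂ (proj₂ (blockMinimum x)) z
    (∼-trans (n , λ p → asym⊏ l (≪⇒⊏ p)) (enum∼ x 0)) l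

  next-covers : ∀ x → Covers x (next x)
  next-covers x with immediateSuccessor x
  ... | _ , l , n , _ = l , λ z (a , b) → n z a b

  -- The witness lists an initial part of the block. As `IsFirst` is Π₂ and `Covers` is Π₁, this
  -- form is Σ₃.
  position-characterised : ∀ x p → position x ≡ p ⟺
    (∃ λ s → IsFirst (entry s 0) × entry s p ≡ x × (∀ i → i < p → Covers (entry s i) (entry s (suc i))))
  position-characterised x p = to' , from'
    where
    to' : _
    to' refl with encode (enum x) (suc (position x))
    ... | s , eq = s , subst IsFirst (sym (eq 0 z<s)) (first-isFirst x) ,
      trans (eq _ ≤-refl) (enum-position x) ,
      λ i lt → subst₂ Covers (sym (eq i (m≤n⇒m≤1+n lt))) (sym (eq (suc i) (s≤s lt))) (next-covers _)
    from' : _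
    from' (s , isF , refl , cov) = count p ≤-refl
      where
      count : ∀ i → i ≤ p → position (entry s i) ≡ i
      count zero    _   = position-first isF
      count (suc i) i<p = trans (position-covers (cov i i<p)) (cong suc (count i (<⇒≤ i<p)))

-- Isomorphisms with ω*η

≅-sym : ∀ {X Y : Set} {R : X → X → Set} {S : Y → Y → Set} → R ≅ S → S ≅ R
≅-sym {S = S} i = record
  { to = from i ; from = to i ; from∘to = to∘from i ; to∘from = from∘to i
  ; pres = λ x y →
      (λ s → proj₂ (pres i (from i x) (from i y)) (subst₂ S (sym (to∘from i x)) (sym (to∘from i y)) s)) ,
      (λ r → subst₂ S (to∘from i x) (to∘from i y) (proj₁ (pres i (from i x) (from i y)) r)) }

≅-trans : ∀ {X Y Z : Set} {R : X → X → Set} {S : Y → Y → Set} {T : Z → Z → Set} →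
          R ≅ S → S ≅ T → R ≅ T
≅-trans i j = record
  { to = to j ∘ to i ; from = from i ∘ from j
  ; from∘to = λ x → trans (cong (from i) (from∘to j (to i x))) (from∘to i x)
  ; to∘from = λ x → trans (cong (to j) (to∘from i (from j x))) (to∘from j x)
  ; pres = λ x y → proj₁ (pres j _ _) ∘ proj₁ (pres i x y) , proj₂ (pres i x y) ∘ proj₂ (pres j _ _) }

module Classification (em : ExcludedMiddle 0ℓ)
                      (val : ℕ → ℚ) (val-surjective : ∀ r → ∃ λ e → val e ≡ r)
                      {_⊏_ : ℕ → ℕ → Set} (B : Blocks _⊏_) where
  open BlockTheory em B public
  open Cantor em val val-surjective ≪-dense public

  key : ℕ → ℚ
  key x = val (q x)

  key≡⇒∼ : ∀ {x y} → key x ≡ key y → x ∼ y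
  key≡⇒∼ {x} {y} e = (λ p → ℚ.<-irrefl e (proj₁ (q-embeds x y) p)) ,
                     (λ p → ℚ.<-irrefl (sym e) (proj₁ (q-embeds y x) p))

  ∼⇒key≡ : ∀ {x y} → x ∼ y → key x ≡ key y
  ∼⇒key≡ {x} {y} (a , b) with ℚ.<-cmp (key x) (key y)
  ... | tri< l _ _ = ⊥-elim (a (proj₂ (q-embeds x y) l))
  ... | tri≈ _ e _ = e
  ... | tri> _ _ l = ⊥-elim (b (proj₂ (q-embeds y x) l))

  classify : _⊏_ ≅ _<ωη_
  classify = record
    { to      = λ x → position x , key x
    ; from    = λ (n , r) → enum (rep r) n
    ; from∘to = λ x → trans (enum-cong (key≡⇒∼ (key-rep (key x))) (position x)) (enum-position x)
    ; to∘from = λ (n , r) → cong₂ _,_ (position-enum (rep r) n)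
                              (trans (∼⇒key≡ (enum∼ (rep r) n)) (key-rep r))
    ; pres    = λ x y → to' x y , from' x y
    }
    where
    rep : ℚ → ℕ
    rep r = proj₁ (q-surjective r)
    key-rep : ∀ r → key (rep r) ≡ r
    key-rep r = proj₂ (q-surjective r)
    to' : ∀ x y → x ⊏ y → (position x , key x) <ωη (position y , key y)
    to' x y l with em {x ≪ y}
    ... | yes p = inj₁ (proj₁ (q-embeds x y) p)
    ... | no np = inj₂ (∼⇒key≡ x∼y , proj₁ (position-order x∼y) l)
      where x∼y = np , λ p → asym⊏ l (≪⇒⊏ p)
    from' : ∀ x y → (position x , key x) <ωη (position y , key y) → x ⊏ y
    from' x y (inj₁ l)       = ≪⇒⊏ (proj₂ (q-embeds x y) l)
    from' x y (inj₂ (e , l)) = proj₂ (position-order (key≡⇒∼ e)) l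

module _ {_⊏_ : ℕ → ℕ → Set} (i : _<ωη_ ≅ _⊏_) where

  private
    idx = proj₁ ∘ from i
    key = proj₂ ∘ from i

    module D = DenseOrder ℚ-denseOrder

    order : ∀ x y → x ⊏ y ⟺ (from i x <ωη from i y)
    order x y = proj₁ (pres (≅-sym i) x y) , proj₂ (pres (≅-sym i) x y)

    to-key : ∀ {r n} → key (to i (n , r)) ≡ r
    to-key {r} {n} = cong proj₂ (from∘to i (n , r))

  ωη-irrefl : ∀ {u} → ¬ u <ωη u
  ωη-irrefl (inj₁ l)       = ℚ.<-irrefl refl l
  ωη-irrefl (inj₂ (_ , l)) = <-irrefl refl l

  ωη-trans : ∀ {u v w} → u <ωη v → v <ωη w → u <ωη w
  ωη-trans (inj₁ a)          (inj₁ b)          = inj₁ (ℚ.<-trans a b)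
  ωη-trans (inj₁ a)          (inj₂ (refl , _)) = inj₁ a
  ωη-trans (inj₂ (refl , _)) (inj₁ b)          = inj₁ b
  ωη-trans (inj₂ (refl , a)) (inj₂ (refl , b)) = inj₂ (refl , <-trans a b)

  ωη-compare : ∀ u v → u <ωη v ⊎ u ≡ v ⊎ v <ωη u
  ωη-compare (n , r) (m , s) with ℚ.<-cmp r s | <-cmp n m
  ... | tri< l _ _    | _             = inj₁ (inj₁ l)
  ... | tri> _ _ l    | _             = inj₂ (inj₂ (inj₁ l))
  ... | tri≈ _ refl _ | tri< l _ _    = inj₁ (inj₂ (refl , l))
  ... | tri≈ _ refl _ | tri≈ _ refl _ = inj₂ (inj₁ refl)
  ... | tri≈ _ refl _ | tri> _ _ l    = inj₂ (inj₂ (inj₂ (refl , l)))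

  ωη-blocks : Blocks _⊏_
  ωη-blocks = record
    { linear = record
      { irrefl⊏ = λ {x} → ωη-irrefl ∘ proj₁ (order x x)
      ; trans⊏  = λ {x} {y} {z} a b → proj₂ (order x z) (ωη-trans (proj₁ (order x y) a) (proj₁ (order y z) b))
      ; compare = compare'
      }
    ; _≪_ = λ x y → key x ℚ.< key y
    ; ≪-dense = record
      { asym    = D.asym
      ; cotrans = λ z → D.cotrans (key z)
      ; dense   = λ l → let r , a , b = D.dense l in
          to i (0 , r) , subst (_ ℚ.<_) (sym to-key) a , subst (ℚ._< _) (sym to-key) b
      ; upper   = λ x → let r , a = D.upper (key x) in to i (0 , r) , subst (key x ℚ.<_) (sym to-key) a
      ; lower   = λ x → let r , a = D.lower (key x) in to i (0 , r) , subst (ℚ._< key x) (sym to-key) a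
      }
    ; ≪⇒⊏ = λ l → proj₂ (order _ _) (inj₁ l)
    ; bounded = bounded'
    ; unending = λ x → to i (suc (idx x) , key x) ,
        proj₂ (order _ _) (subst (from i x <ωη_) (sym (from∘to i _)) (inj₂ (refl , ≤-refl))) ,
        λ l → ℚ.<-irrefl (sym to-key) l
    }
    where
    compare' : ∀ x y → x ⊏ y ⊎ x ≡ y ⊎ y ⊏ x
    compare' x y with ωη-compare (from i x) (from i y)
    ... | inj₁ l        = inj₁ (proj₂ (order x y) l)
    ... | inj₂ (inj₁ e) = inj₂ (inj₁ (trans (sym (to∘from i x)) (trans (cong (to i) e) (to∘from i y))))
    ... | inj₂ (inj₂ l) = inj₂ (inj₂ (proj₂ (order y x) l))
    bounded' : ∀ x → ∃ λ b → ∀ z → z ⊏ x → ¬ key z ℚ.< key x → z < b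
    bounded' x with maximum (λ j → to i (j , key x)) (idx x)
    ... | b , bd = b , λ z z⊏x n → case proj₁ (order z x) z⊏x of λ where
      (inj₁ l)       → ⊥-elim (n l)
      (inj₂ (e , l)) → subst (_< b) (trans (cong (λ r → to i (idx z , r)) (sym e)) (to∘from i z)) (bd (idx z) l)

-- Closure properties of Σ₃ predicates

record Sigma3 {n} (P : Vec ℕ n → Set) : Set₁ where
  constructor sigma3
  field
    {matrix} : Vec ℕ (3 + n) → Set
    dec      : Decᵖ zero-oracle matrix
    normal   : ∀ xs → P xs ⟺ (∃ λ a → ∀ b → ∃ λ c → matrix (a ∷ b ∷ c ∷ xs))

drop3 : ∀ {n} → PrimRecs zero-oracle (λ (xs : Vec ℕ (3 + n)) → tail (tail (tail xs)))
drop3 = tailᵖ (tailᵖ (tailᵖ idᵖ))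

module _ {n} {P Q : Vec ℕ n → Set} where

  equiv₃ : (∀ xs → P xs ⟺ Q xs) → Sigma3 P → Sigma3 Q
  equiv₃ e (sigma3 d s) = sigma3 d λ xs →
    proj₁ (s xs) ∘ proj₂ (e xs) , proj₁ (e xs) ∘ proj₂ (s xs)

  infixr 2 _×₃_
  _×₃_ : Sigma3 P → Sigma3 Q → Sigma3 (λ xs → P xs × Q xs)
  sigma3 d s ×₃ sigma3 e t = sigma3
    (subᵈ d (π₁ᵖ (var 0F) ∷ᵖ var 1F ∷ᵖ π₁ᵖ (var 2F) ∷ᵖ drop3) ×ᵈ
     subᵈ e (π₂ᵖ (var 0F) ∷ᵖ var 1F ∷ᵖ π₂ᵖ (var 2F) ∷ᵖ drop3))
    λ xs → to' xs , from' xs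
    where
    M = Sigma3.matrix (sigma3 {P = P} d s)
    N = Sigma3.matrix (sigma3 {P = Q} e t)
    to' : ∀ xs → P xs × Q xs → _
    to' xs (p , q) with proj₁ (s xs) p | proj₁ (t xs) q
    ... | a , f | a' , f' = ⟨ a , a' ⟩ , λ b → let c , m = f b ; c' , m' = f' b in ⟨ c , c' ⟩ ,
      subst₂ (λ a c → M (a ∷ b ∷ c ∷ xs)) (sym (π₁-pair a a')) (sym (π₁-pair c c')) m ,
      subst₂ (λ a c → N (a ∷ b ∷ c ∷ xs)) (sym (π₂-pair a a')) (sym (π₂-pair c c')) m'
    from' : ∀ xs → _ → P xs × Q xs
    from' xs (a , f) = proj₂ (s xs) (π₁ a , λ b → let c , m , _ = f b in π₁ c , m) ,
                       proj₂ (t xs) (π₂ a , λ b → let c , _ , m = f b in π₂ c , m)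

sub₃ : ∀ {m n} {P : Vec ℕ m → Set} {G : Vec ℕ n → Vec ℕ m} →
       Sigma3 P → PrimRecs zero-oracle G → Sigma3 (P ∘ G)
sub₃ {G = G} (sigma3 d s) p =
  sigma3 (subᵈ d (var 0F ∷ᵖ var 1F ∷ᵖ var 2F ∷ᵖ drop3 ⨟ p)) λ xs → s (G xs)

dec₃ : ∀ {n} {P : Vec ℕ n → Set} → Decᵖ zero-oracle P → Sigma3 P
dec₃ d = sigma3 (subᵈ d drop3) λ xs → (λ p → 0 , λ _ → 0 , p) , λ (_ , f) → proj₂ (f 0)

∀∃₃ : ∀ {n} {M : Vec ℕ (2 + n) → Set} → Decᵖ zero-oracle M →
      Sigma3 (λ xs → ∀ b → ∃ λ c → M (b ∷ c ∷ xs))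
∀∃₃ d = sigma3 (subᵈ d (tailᵖ idᵖ)) λ xs → (λ f → 0 , f) , proj₂

∃∀₃ : ∀ {n} {M : Vec ℕ (2 + n) → Set} → Decᵖ zero-oracle M →
      Sigma3 (λ xs → ∃ λ a → ∀ b → M (a ∷ b ∷ xs))
∃∀₃ d = sigma3 (subᵈ d (var 0F ∷ᵖ var 1F ∷ᵖ drop3)) λ xs →
  (λ (a , f) → a , λ b → 0 , f b) , λ (a , f) → a , λ b → proj₂ (f b)

∃₃ : ∀ {n} {P : Vec ℕ (suc n) → Set} → Sigma3 P → Sigma3 (λ xs → ∃ λ x → P (x ∷ xs))
∃₃ {P = P} (sigma3 {M} d s) = sigma3
  (subᵈ d (π₁ᵖ (var 0F) ∷ᵖ var 1F ∷ᵖ var 2F ∷ᵖ π₂ᵖ (var 0F) ∷ᵖ drop3))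
  λ xs → to' xs , λ (a , f) → π₂ a , proj₂ (s (π₂ a ∷ xs)) (π₁ a , f)
  where
  to' : ∀ xs → (∃ λ x → P (x ∷ xs)) → _
  to' xs (x , p) with proj₁ (s (x ∷ xs)) p
  ... | a , f = ⟨ a , x ⟩ , λ b → let c , m = f b in c ,
    subst₂ (λ a x → M (a ∷ b ∷ c ∷ x ∷ xs)) (sym (π₁-pair a x)) (sym (π₂-pair a x)) m

infixr 0 _→₃_
_→₃_ : ∀ {n} {D P : Vec ℕ n → Set} → Decᵖ zero-oracle D → Sigma3 P → Sigma3 (λ xs → D xs → P xs)
_→₃_ {D = D} {P} e (sigma3 d s) = sigma3 (subᵈ e drop3 →ᵈ d) λ xs → to' xs ,
    λ (a , f) x → proj₂ (s xs) (a , λ b → let c , m = f b in c , m x)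
  where
  to' : ∀ xs → (D xs → P xs) → _
  to' xs f with decide e xs
  ... | yes x = let a , g = proj₁ (s xs) (f x) in a , λ b → let c , m = g b in c , λ _ → m
  ... | no nx = 0 , λ _ → 0 , λ x → ⊥-elim (nx x)

infixr 1 _⊎₃_
-- A disjunction is an existential over a selector `j` with decidable guards.
_⊎₃_ : ∀ {n} {P Q : Vec ℕ n → Set} → Sigma3 P → Sigma3 Q → Sigma3 (λ xs → P xs ⊎ Q xs)
_⊎₃_ {P = P} {Q} p q = equiv₃ (λ xs → to' xs , from' xs)
  (∃₃ ((j≡0 →₃ sub₃ p (tailᵖ idᵖ)) ×₃ (¬ᵈ j≡0 →₃ sub₃ q (tailᵖ idᵖ))))
  where
  j≡0 : ∀ {n} → Decᵖ zero-oracle (λ (xs : Vec ℕ (suc n)) → lookup xs 0F ≡ 0)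
  j≡0 = var 0F ≡ᵈ const 0
  to' : ∀ xs → _ → P xs ⊎ Q xs
  to' xs (zero  , f , _) = inj₁ (f refl)
  to' xs (suc _ , _ , f) = inj₂ (f λ ())
  from' : ∀ xs → P xs ⊎ Q xs → _
  from' xs (inj₁ x) = 0 , (λ _ → x) , λ ne → ⊥-elim (ne refl)
  from' xs (inj₂ y) = 1 , (λ ()) , λ _ → y

-- The finitely many outer witnesses fit into one coded sequence `a`, and the bounded variable is
-- paired with the universal one.
∀<₃ : ∀ {n} {P : Vec ℕ (suc n) → Set} {F : Vec ℕ n → ℕ} → Sigma3 P → PrimRec zero-oracle F →
      Sigma3 (λ xs → ∀ i → i < F xs → P (i ∷ xs))
∀<₃ {P = P} {F} (sigma3 {M} d s) p = sigma3
  ((π₁ᵖ (var 1F) <ᵈ sub p drop3) →ᵈ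
   subᵈ d (entryᵖ (var 0F) (π₁ᵖ (var 1F)) ∷ᵖ π₂ᵖ (var 1F) ∷ᵖ var 2F ∷ᵖ π₁ᵖ (var 1F) ∷ᵖ drop3))
  λ xs → to' xs , from' xs
  where
  to' : ∀ xs → (∀ i → i < F xs → P (i ∷ xs)) → _
  to' xs f with choose (F xs) (λ i lt → proj₁ (s (i ∷ xs)) (f i lt))
  ... | h , w with encode h (F xs)
  ... | a , e = a , λ b → matrix b
    where
    matrix : ∀ b → ∃ λ c → π₁ b < F xs → M (entry a (π₁ b) ∷ π₂ b ∷ c ∷ π₁ b ∷ xs)
    matrix b with π₁ b <? F xs
    ... | yes lt = let c , m = w (π₁ b) lt (π₂ b) in c , λ _ →
                   subst (λ a → M (a ∷ π₂ b ∷ c ∷ π₁ b ∷ xs)) (sym (e (π₁ b) lt)) m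
    ... | no nlt = 0 , λ lt → ⊥-elim (nlt lt)
  from' : ∀ xs → _ → ∀ i → i < F xs → P (i ∷ xs)
  from' xs (a , f) i lt = proj₂ (s (i ∷ xs)) (entry a i , λ b → let c , m = f ⟨ i , b ⟩ in c ,
    subst₂ (λ i b → M (entry a i ∷ b ∷ c ∷ i ∷ xs)) (π₁-pair i b) (π₂-pair i b)
      (m (subst (_< F xs) (sym (π₁-pair i b)) lt)))

graph⇒Σ3 : ∀ {f : ℕ → ℕ} → Sigma3 (λ xs → f (lookup xs 0F) ≡ lookup xs 1F) → Σ3Graph f
graph⇒Σ3 (sigma3 {M} (decᵖ p sound) s) = PrimRec.term r , λ x y →
    (λ e → let a , f = proj₁ (s (x ∷ y ∷ [])) e in
           a , λ b → let c , m = f b in c , trans (PrimRec.correct r _) (proj₁ (sound _) m)) ,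
    (λ (a , f) → proj₂ (s (x ∷ y ∷ [])) (a , λ b → let c , e = f b in
           c , proj₂ (sound _) (trans (sym (PrimRec.correct r _)) e)))
  where
  r = sub p (var 2F ∷ᵖ var 3F ∷ᵖ var 4F ∷ᵖ var 0F ∷ᵖ var 1F ∷ᵖ []ᵖ)

module Arithmetic (em : ExcludedMiddle 0ℓ) where
  open Classical em

  -- The Π₃ form of f x ≡ y says that f x ≡ y' fails for every y' ≢ y.
  Σ3⇒Δ3 : ∀ {f : ℕ → ℕ} → Σ3Graph f → Δ3 f
  Σ3⇒Δ3 {f} (R , s) = (R , s) , PrimRec.term (Decᵖ.prim d) , λ x y → to' x y , from' x y
    where
    d : Decᵖ zero-oracle {5} (λ xs → lookup xs 1F ≡ π₁ (lookup xs 2F) ⊎ ¬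
          (eval zero-oracle R (lookup xs 0F ∷ π₁ (lookup xs 2F) ∷ π₂ (lookup xs 2F) ∷ lookup xs 3F ∷ lookup xs 4F ∷ []) ≡ 0))
    d = (var 1F ≡ᵈ π₁ᵖ (var 2F)) ⊎ᵈ (¬ᵈ (sub (primRec R λ _ → refl)
          (var 0F ∷ᵖ π₁ᵖ (var 2F) ∷ᵖ π₂ᵖ (var 2F) ∷ᵖ var 3F ∷ᵖ var 4F ∷ᵖ []ᵖ) ≡ᵈ const 0))
    module d = Decᵖ d
    Normal : ℕ → ℕ → Set
    Normal x y = ∀ a → ∃ λ b → ∀ c → evalPR (PrimRec.term d.prim) (x ∷ y ∷ a ∷ b ∷ c ∷ []) ≡ 0
    to' : ∀ x y → f x ≡ y → Normal x y
    to' x y refl a with f x ≟ π₁ a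
    ... | yes e = 0 , λ c → trans (PrimRec.correct d.prim _) (proj₁ (d.sound _) (inj₁ e))
    ... | no ne with ¬∀⇒∃¬ (λ all → ne (proj₂ (s x (π₁ a)) (π₂ a , λ b → byContradiction (all b))))
    ...   | b , nn = b , λ c → trans (PrimRec.correct d.prim _)
              (proj₁ (d.sound _) (inj₂ λ e → nn λ n → n (c , e)))
    from' : ∀ x y → Normal x y → f x ≡ y
    from' x y all with proj₁ (s x (f x)) refl
    ... | a , g with all ⟨ f x , a ⟩
    ... | b , h with g b
    ... | c , e with proj₂ (d.sound _) (trans (sym (PrimRec.correct d.prim _)) (h c))
    ... | inj₁ eq = sym (trans eq (π₁-pair (f x) a))
    ... | inj₂ ne rewrite π₁-pair (f x) a | π₂-pair (f x) a = ⊥-elim (ne e)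

  module _ {n} {P D : Vec ℕ n → Set} (p : Sigma3 P) (¬p : Sigma3 (λ xs → ¬ P xs)) (d : Decᵖ zero-oracle D) where

    -- Deciding `D` reduces the equivalence to `P` or to `¬ P`, so both must be Σ₃, as they are for
    -- `≪`.
    ⟺₃ : Sigma3 (λ xs → P xs ⟺ D xs)
    ⟺₃ = equiv₃ (λ xs → (λ (f , g) → (λ x → byContradiction λ nd → g nd x) , f) ,
                        (λ (f , g) → g , λ nd x → nd (f x)))
      ((d →₃ p) ×₃ (¬ᵈ d →₃ ¬p))

    ¬⟺₃ : Sigma3 (λ xs → ¬ (P xs ⟺ D xs))
    ¬⟺₃ = equiv₃ (λ xs → (λ (f , g) (h , k) → let nd = λ y → f y (k y) in nd (h (g nd))) ,
                         (λ n → (λ y x → n ((λ _ → y) , (λ _ → x))) ,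
                                (λ ny → byContradiction λ nx → n ((λ x → ⊥-elim (nx x)) , λ y → ⊥-elim (ny y)))))
      ((d →₃ ¬p) ×₃ (¬ᵈ d →₃ p))

  -- The inverse has the same graph with its arguments swapped, so one Σ₃ definition settles both
  -- directions.
  definable⇒Δ3 : ∀ {R S : ℕ → ℕ → Set} (i : R ≅ S) {P : ℕ → ℕ → Set} →
    Sigma3 {2} (λ xs → P (lookup xs 0F) (lookup xs 1F)) → (∀ x y → P x y ⟺ to i x ≡ y) →
    Δ3 (to i) × Δ3 (from i)
  definable⇒Δ3 i {P} p graph =
    Σ3⇒Δ3 (graph⇒Σ3 (equiv₃ (λ { (x ∷ y ∷ []) → graph x y }) p)) ,
    Σ3⇒Δ3 (graph⇒Σ3 (equiv₃ (λ { (y ∷ x ∷ []) → to' x y , from' x y })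
      (sub₃ p (var 1F ∷ᵖ var 0F ∷ᵖ []ᵖ))))
    where
    to' : ∀ x y → P x y → from i y ≡ x
    to' x y p = trans (cong (from i) (sym (proj₁ (graph x y) p))) (from∘to i x)
    from' : ∀ x y → from i y ≡ x → P x y
    from' x y e = proj₂ (graph x y) (trans (cong (to i) (sym e)) (to∘from i y))

-- Codes of rationals and their primitive recursive comparison

⊖-<-⟺ : ∀ x y z w → x ⊖ y ℤ.< z ⊖ w ⟺ x + w < z + y
⊖-<-⟺ x y z w =
  (λ l → ℤ.drop‿+<+ (subst₂ ℤ._<_ left right (ℤ.+-monoˡ-< (pos (y + w)) l))) ,
  (λ l → cancel (subst₂ ℤ._<_ (sym left) (sym right) (ℤ.+<+ l)))
  where
  left : (x ⊖ y) ℤ.+ pos (y + w) ≡ pos (x + w)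
  left = trans (ℤ.distribˡ-⊖-+-pos (y + w) x y)
    (trans (cong (_⊖ y) (trans (sym (+-assoc x y w)) (trans (cong (_+ w) (+-comm x y)) (+-assoc y x w))))
           (trans (cong (λ v → y + (x + w) ⊖ v) (sym (+-identityʳ y))) (ℤ.+-cancelˡ-⊖ y (x + w) 0)))
  right : (z ⊖ w) ℤ.+ pos (y + w) ≡ pos (z + y)
  right = trans (ℤ.distribˡ-⊖-+-pos (y + w) z w)
    (trans (cong (_⊖ w) (trans (sym (+-assoc z y w)) (+-comm (z + y) w)))
           (trans (cong (λ v → w + (z + y) ⊖ v) (sym (+-identityʳ w))) (ℤ.+-cancelˡ-⊖ w (z + y) 0)))
  cancel : (x ⊖ y) ℤ.+ pos (y + w) ℤ.< (z ⊖ w) ℤ.+ pos (y + w) → x ⊖ y ℤ.< z ⊖ w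
  cancel l = subst₂ ℤ._<_ (undo (x ⊖ y)) (undo (z ⊖ w)) (ℤ.+-monoˡ-< (ℤ.- pos (y + w)) l)
    where
    undo : ∀ i → i ℤ.+ pos (y + w) ℤ.+ ℤ.- pos (y + w) ≡ i
    undo i = trans (ℤ.+-assoc i (pos (y + w)) (ℤ.- pos (y + w)))
      (trans (cong (λ v → i ℤ.+ v) (ℤ.+-inverseʳ (pos (y + w)))) (ℤ.+-identityʳ i))

⊖-* : ∀ x y m → (x ⊖ y) ℤ.* pos m ≡ x * m ⊖ y * m
⊖-* x y m = trans (cong (ℤ._* pos m) (sym (ℤ.m-n≡m⊖n x y)))
  (trans (ℤ.*-distribʳ-+ (pos m) (pos x) (ℤ.- pos y))
  (trans (cong₂ ℤ._+_ (sym (ℤ.pos-* x m))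
           (trans (sym (ℤ.neg-distribˡ-* (pos y) (pos m))) (cong ℤ.-_ (sym (ℤ.pos-* y m)))))
  (ℤ.m-n≡m⊖n (x * m) (y * m))))

opaque
  -- The fraction (a - b)/(c + 1). Differences of naturals in the numerator let `frac-<` be stated
  -- within ℕ.
  frac : ℕ → ℕ → ℕ → ℚ
  frac a b c = ℚ.fromℚᵘ (mkℚᵘ (a ⊖ b) c)

  frac-< : ∀ a b c a' b' c' → frac a b c ℚ.< frac a' b' c' ⟺
           a * suc c' + b' * suc c < a' * suc c + b * suc c'
  frac-< a b c a' b' c' =
    (λ l → proj₁ (⊖-<-⟺ (a * suc c') (b * suc c') (a' * suc c) (b' * suc c))
      (subst₂ ℤ._<_ (⊖-* a b (suc c')) (⊖-* a' b' (suc c)) (ℚᵘ.drop-*<*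
        (ℚᵘ.<-respˡ-≃ (ℚ.toℚᵘ-fromℚᵘ p) (ℚᵘ.<-respʳ-≃ (ℚ.toℚᵘ-fromℚᵘ p') (ℚ.toℚᵘ-mono-< l)))))) ,
    (λ l → ℚ.toℚᵘ-cancel-< (ℚᵘ.<-respˡ-≃ (ℚᵘ.≃-sym (ℚ.toℚᵘ-fromℚᵘ p))
        (ℚᵘ.<-respʳ-≃ (ℚᵘ.≃-sym (ℚ.toℚᵘ-fromℚᵘ p')) (*<* (subst₂ ℤ._<_ (sym (⊖-* a b (suc c'))) (sym (⊖-* a' b' (suc c)))
          (proj₂ (⊖-<-⟺ (a * suc c') (b * suc c') (a' * suc c) (b' * suc c)) l))))))
    where
    p p' : ℚᵘ.ℚᵘ
    p = mkℚᵘ (a ⊖ b) c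
    p' = mkℚᵘ (a' ⊖ b') c'

  frac-surjective : ∀ r → ∃ λ a → ∃ λ b → ∃ λ c → frac a b c ≡ r
  frac-surjective r@(mkℚ (pos a) c _)      = a , 0 , c , ℚ.fromℚᵘ-toℚᵘ r
  frac-surjective r@(mkℚ (-[1+ b ]) c _) = 0 , suc b , c , ℚ.fromℚᵘ-toℚᵘ r

  frac-nonNegative : ∀ r → ¬ r ℚ.< frac 0 0 0 → ∃ λ a → ∃ λ c → frac a 0 c ≡ r
  frac-nonNegative r@(mkℚ (pos a) c _)      _  = a , c , ℚ.fromℚᵘ-toℚᵘ r
  frac-nonNegative r@(mkℚ (-[1+ b ]) c _) nl =
    ⊥-elim (nl (subst (ℚ._< frac 0 0 0) (ℚ.fromℚᵘ-toℚᵘ r) (proj₂ (frac-< 0 (suc b) c 0 0 0) z<s)))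

frac<ᵈ : ∀ {g n} {A B C A' B' C' : Vec ℕ n → ℕ} →
  PrimRec g A → PrimRec g B → PrimRec g C → PrimRec g A' → PrimRec g B' → PrimRec g C' →
  Decᵖ g (λ xs → frac (A xs) (B xs) (C xs) ℚ.< frac (A' xs) (B' xs) (C' xs))
frac<ᵈ {A = A} {B} {C} {A'} {B'} {C'} a b c a' b' c' =
  equivᵈ (λ xs → let e = frac-< (A xs) (B xs) (C xs) (A' xs) (B' xs) (C' xs) in proj₂ e , proj₁ e)
    ((a *ᵖ sucᵖ c' +ᵖ b' *ᵖ sucᵖ c) <ᵈ (a' *ᵖ sucᵖ c +ᵖ b *ᵖ sucᵖ c'))

-- The first component of a code is ignored, so every rational has arbitrarily large codes.
val : ℕ → ℚ
val e = frac (π₁ (π₂ (π₂ e))) (π₁ (π₂ e)) (π₂ (π₂ (π₂ e)))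

val-code : ∀ n a b c → val ⟨ n , ⟨ b , ⟨ a , c ⟩ ⟩ ⟩ ≡ frac a b c
val-code n a b c rewrite π₂-pair n ⟨ b , ⟨ a , c ⟩ ⟩ | π₁-pair b ⟨ a , c ⟩ | π₂-pair b ⟨ a , c ⟩
                       | π₁-pair a c | π₂-pair a c = refl

val-surjective : ∀ r → ∃ λ e → val e ≡ r
val-surjective r with frac-surjective r
... | a , b , c , e = ⟨ 0 , ⟨ b , ⟨ a , c ⟩ ⟩ ⟩ , trans (val-code 0 a b c) e

val-repeats : ∀ e n → val ⟨ n , π₂ e ⟩ ≡ val e
val-repeats e n rewrite π₂-pair n (π₂ e) = refl

val<ᵈ : ∀ {g n} {F G : Vec ℕ n → ℕ} → PrimRec g F → PrimRec g G →
        Decᵖ g (λ xs → val (F xs) ℚ.< val (G xs))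
val<ᵈ p q = frac<ᵈ (π₁ᵖ (π₂ᵖ (π₂ᵖ p))) (π₁ᵖ (π₂ᵖ p)) (π₂ᵖ (π₂ᵖ (π₂ᵖ p)))
                   (π₁ᵖ (π₂ᵖ (π₂ᵖ q))) (π₁ᵖ (π₂ᵖ q)) (π₂ᵖ (π₂ᵖ (π₂ᵖ q)))

≡⟺≮×≯ : ∀ {r s} → (¬ r ℚ.< s × ¬ s ℚ.< r) ⟺ r ≡ s
≡⟺≮×≯ {r} {s} = to' , λ { refl → ℚ.<-irrefl refl , ℚ.<-irrefl refl }
  where
  to' : ¬ r ℚ.< s × ¬ s ℚ.< r → r ≡ s
  to' (a , b) with ℚ.<-cmp r s
  ... | tri< l _ _ = ⊥-elim (a l)
  ... | tri≈ _ e _ = e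
  ... | tri> _ _ l = ⊥-elim (b l)

val≡ᵈ : ∀ {g n} {F G : Vec ℕ n → ℕ} → PrimRec g F → PrimRec g G →
        Decᵖ g (λ xs → val (F xs) ≡ val (G xs))
val≡ᵈ p q = equivᵈ (λ xs → ≡⟺≮×≯) ((¬ᵈ val<ᵈ p q) ×ᵈ (¬ᵈ val<ᵈ q p))

-- Σ₃ definitions of the two coordinates

module Definability (em : ExcludedMiddle 0ℓ) (A : Punctual) (B : Blocks (Rel A)) where
  open Classical em
  open Arithmetic em
  open Classification em val val-surjective B public

  private
    between : ∀ {n} {F G H : Vec ℕ n → ℕ} → PrimRec zero-oracle F → PrimRec zero-oracle G → PrimRec zero-oracle H →
              Decᵖ zero-oracle (λ xs → Between (F xs) (G xs) (H xs))
    between p q r = Relᵈ A p r ×ᵈ Relᵈ A r q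

  ≪₃ : Sigma3 {2} (λ xs → lookup xs 0F ≪ lookup xs 1F)
  ≪₃ = equiv₃ (λ { (x ∷ y ∷ []) → proj₂ (≪⟺unboundedly x y) , proj₁ (≪⟺unboundedly x y) })
    (∀∃₃ ((var 0F ≤ᵈ var 1F) ×ᵈ between (var 2F) (var 3F) (var 1F)))

  ≪̸₃ : Sigma3 {2} (λ xs → ¬ lookup xs 0F ≪ lookup xs 1F)
  ≪̸₃ = equiv₃ (λ { (x ∷ y ∷ []) →
      (λ (a , f) p → let c , m = proj₁ (≪⟺unboundedly x y) p a in f c m) ,
      (λ n → let a , m = ¬∀⇒∃¬ (λ u → n (proj₂ (≪⟺unboundedly x y) u)) in a , λ c q → m (c , q)) })
    (∃∀₃ (¬ᵈ ((var 0F ≤ᵈ var 1F) ×ᵈ between (var 2F) (var 3F) (var 1F))))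

  isFirst₃ : Sigma3 {1} (λ xs → IsFirst (lookup xs 0F))
  isFirst₃ = equiv₃ (λ { (m ∷ []) → to' m , from' m })
    -- `b` codes both the point `z` and the lower bound for the witness, which merges two universal
    -- quantifiers.
    (∀∃₃ {M = M} (Relᵈ A (π₁ᵖ (var 0F)) (var 2F) →ᵈ
      (π₂ᵖ (var 0F) ≤ᵈ var 1F) ×ᵈ between (π₁ᵖ (var 0F)) (var 2F) (var 1F)))
    where
    M : Vec ℕ 3 → Set
    M xs = Rel A (π₁ (lookup xs 0F)) (lookup xs 2F) →
      (π₂ (lookup xs 0F) ≤ lookup xs 1F × Between (π₁ (lookup xs 0F)) (lookup xs 2F) (lookup xs 1F))
    to' : ∀ m → (∀ b → ∃ λ c → M (b ∷ c ∷ m ∷ [])) → IsFirst m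
    to' m f z l = proj₂ (≪⟺unboundedly z m) λ b → let c , k = f ⟨ z , b ⟩ in
      c , subst₂ (λ z b → Rel A z m → b ≤ c × Between z m c) (π₁-pair z b) (π₂-pair z b) k l
    from' : ∀ m → IsFirst m → ∀ b → ∃ λ c → M (b ∷ c ∷ m ∷ [])
    from' m isF b with em {Rel A (π₁ b) m}
    ... | yes l = let c , k = proj₁ (≪⟺unboundedly (π₁ b) m) (isF (π₁ b) l) (π₂ b) in c , λ _ → k
    ... | no nl = 0 , λ l → ⊥-elim (nl l)

  covers₃ : Sigma3 {2} (λ xs → Covers (lookup xs 0F) (lookup xs 1F))
  covers₃ = equiv₃ (λ { (x ∷ y ∷ []) →
      (λ f → proj₁ (proj₂ (f 0)) , λ z → proj₂ (proj₂ (f z))) ,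
      (λ (l , f) z → 0 , l , f z) })
    (∀∃₃ (Relᵈ A (var 2F) (var 3F) ×ᵈ (¬ᵈ between (var 2F) (var 3F) (var 0F))))

  position₃ : Sigma3 {2} (λ xs → position (lookup xs 0F) ≡ lookup xs 1F)
  position₃ = equiv₃ (λ { (x ∷ p ∷ []) → let e = position-characterised x p in proj₂ e , proj₁ e })
    (∃₃ (sub₃ isFirst₃ (entryᵖ (var 0F) (const 0) ∷ᵖ []ᵖ) ×₃
         dec₃ (entryᵖ (var 0F) (var 2F) ≡ᵈ var 1F) ×₃
         ∀<₃ (sub₃ covers₃ (entryᵖ (var 1F) (var 0F) ∷ᵖ entryᵖ (var 1F) (sucᵖ (var 0F)) ∷ᵖ []ᵖ)) (var 2F)))

  private
    v<r : Decᵖ zero-oracle {4} (λ xs → val (entry (lookup xs 2F) (lookup xs 0F)) ℚ.< val (lookup xs 1F))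
    v<r = val<ᵈ (entryᵖ (var 2F) (var 0F)) (var 1F)

    r<v : Decᵖ zero-oracle {4} (λ xs → val (lookup xs 1F) ℚ.< val (entry (lookup xs 2F) (lookup xs 0F)))
    r<v = val<ᵈ (var 1F) (entryᵖ (var 2F) (var 0F))

    FitsAt : Vec ℕ 4 → Set
    FitsAt xs = Fits (entry (lookup xs 2F)) (lookup xs 3F) (lookup xs 1F) (lookup xs 0F)

    t≪s : PrimRecs zero-oracle {n = 4} (λ xs → lookup xs 0F ∷ lookup xs 3F ∷ [])
    t≪s = var 0F ∷ᵖ var 3F ∷ᵖ []ᵖ

    s≪t : PrimRecs zero-oracle {n = 4} (λ xs → lookup xs 3F ∷ lookup xs 0F ∷ [])
    s≪t = var 3F ∷ᵖ var 0F ∷ᵖ []ᵖ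

  fits₃ : Sigma3 FitsAt
  fits₃ = ⟺₃ (sub₃ ≪₃ t≪s) (sub₃ ≪̸₃ t≪s) v<r ×₃ ⟺₃ (sub₃ ≪₃ s≪t) (sub₃ ≪̸₃ s≪t) r<v

  ¬fits₃ : Sigma3 (λ xs → ¬ FitsAt xs)
  ¬fits₃ = equiv₃ (λ xs → (λ { (inj₁ n) (p , _) → n p ; (inj₂ n) (_ , p) → n p }) , ¬×⇒¬⊎¬)
    (¬⟺₃ (sub₃ ≪₃ t≪s) (sub₃ ≪̸₃ t≪s) v<r ⊎₃ ¬⟺₃ (sub₃ ≪₃ s≪t) (sub₃ ≪̸₃ s≪t) r<v)
    where
    ¬×⇒¬⊎¬ : ∀ {P Q : Set} → ¬ (P × Q) → ¬ P ⊎ ¬ Q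
    ¬×⇒¬⊎¬ {P} n with em {P}
    ... | yes p = inj₂ λ q → n (p , q)
    ... | no np = inj₁ np

  private
    FitsBelowAt : Vec ℕ 3 → Set
    FitsBelowAt xs = FitsBelow (entry (lookup xs 1F)) (lookup xs 2F) (lookup xs 0F)

  fitsBelow₃ : Sigma3 FitsBelowAt
  fitsBelow₃ = ∀<₃ fits₃ (var 2F)

  ¬fitsBelow₃ : Sigma3 (λ xs → ¬ FitsBelowAt xs)
  ¬fitsBelow₃ = equiv₃ (λ xs → (λ (t , lt , n) f → n (f t lt)) ,
      λ n → byContradiction λ m → n λ t lt → byContradiction λ k → m (t , lt , k))
    (∃₃ (dec₃ (var 0F <ᵈ var 3F) ×₃ ¬fits₃))

  -- Minimality negates `FitsBelow`; this is why the negations are carried along as Σ₃ predicates of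
  -- their own.
  step₃ : Sigma3 {2} (λ xs → Step (entry (lookup xs 1F)) (lookup xs 0F))
  step₃ = sub₃ fitsBelow₃ (entryᵖ (var 1F) (var 0F) ∷ᵖ var 1F ∷ᵖ var 0F ∷ᵖ []ᵖ) ×₃
    ∀<₃ (sub₃ ¬fitsBelow₃ (var 0F ∷ᵖ var 2F ∷ᵖ var 1F ∷ᵖ []ᵖ)) (entryᵖ (var 1F) (var 0F))

  q₃ : Sigma3 {2} (λ xs → q (lookup xs 0F) ≡ lookup xs 1F)
  q₃ = equiv₃ (λ { (x ∷ r ∷ []) → let e = q-characterised x r in proj₂ e , proj₁ e })
    (∃₃ (dec₃ (entryᵖ (var 0F) (var 1F) ≡ᵈ var 2F) ×₃
         ∀<₃ (sub₃ step₃ (var 0F ∷ᵖ var 1F ∷ᵖ []ᵖ)) (sucᵖ (var 1F))))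

-- A Δ₃ isomorphism between any two punctual copies

module _ (em : ExcludedMiddle 0ℓ) (A A' : Punctual)
         (B : Blocks (Rel A)) (B' : Blocks (Rel A')) where
  private
    module D  = Definability em A B
    module D' = Definability em A' B'
  open Arithmetic em

  canonical : Rel A ≅ Rel A'
  canonical = ≅-trans D.classify (≅-sym D'.classify)

  -- The two copies may choose different codes `r` and `r'` of the same rational.
  SameCoordinates : ℕ → ℕ → Set
  SameCoordinates x y = ∃ λ p → ∃ λ r → ∃ λ r' →
    D.position x ≡ p × D'.position y ≡ p × D.q x ≡ r × D'.q y ≡ r' × val r ≡ val r'

  opaque
    sameCoordinates₃ : Sigma3 {2} (λ xs → SameCoordinates (lookup xs 0F) (lookup xs 1F))
    sameCoordinates₃ = ∃₃ (∃₃ (∃₃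
      (sub₃ D.position₃ (var 3F ∷ᵖ var 2F ∷ᵖ []ᵖ) ×₃ sub₃ D'.position₃ (var 4F ∷ᵖ var 2F ∷ᵖ []ᵖ) ×₃
       sub₃ D.q₃ (var 3F ∷ᵖ var 1F ∷ᵖ []ᵖ) ×₃ sub₃ D'.q₃ (var 4F ∷ᵖ var 0F ∷ᵖ []ᵖ) ×₃
       dec₃ (val≡ᵈ (var 1F) (var 0F)))))

  canonical-graph : ∀ x y → SameCoordinates x y ⟺ to canonical x ≡ y
  canonical-graph x y =
    (λ { (_ , _ , _ , refl , e , refl , refl , k) →
         trans (cong (from D'.classify) (cong₂ _,_ (sym e) k)) (from∘to D'.classify y) }) ,
    (λ { refl → let e = sym (to∘from D'.classify (to D.classify x)) in
         _ , _ , _ , refl , sym (cong proj₁ e) , refl , refl , cong proj₂ e })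

  canonical-Δ3 : Δ3 (to canonical) × Δ3 (from canonical)
  canonical-Δ3 = definable⇒Δ3 canonical sameCoordinates₃ canonical-graph

-- The given `i` and `j` may be arbitrarily complex and only supply the block structures; the
-- isomorphism returned is `canonical`.
cone⇒prCat : ExcludedMiddle 0ℓ → ∀ A → _<ωη_ ≅ Rel A → ∀ d → Cone d → PrCat A d
cone⇒prCat em A i d cone A' j = canonical em A A' B B' , cone _ (proj₁ δ) , cone _ (proj₂ δ)
  where
  B  = ωη-blocks i
  B' = ωη-blocks (≅-trans i j)
  δ  = canonical-Δ3 em A A' B B'

-- Linear orders from keys

Lex : ∀ {X Y : Set} → (X → X → Set) → (Y → Y → Set) → X × Y → X × Y → Set
Lex R S (x , y) (x' , y') = R x x' ⊎ x ≡ x' × S y y'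

module _ {X : Set} {R : X → X → Set} where

  lex-linear : ∀ {Y : Set} {S : Y → Y → Set} → StrictLinear R → StrictLinear S → StrictLinear (Lex R S)
  lex-linear {S = S} L M = record
    { irrefl⊏ = λ { (inj₁ p) → L.irrefl⊏ p ; (inj₂ (_ , p)) → M.irrefl⊏ p }
    ; trans⊏  = λ { (inj₁ p) (inj₁ q) → inj₁ (L.trans⊏ p q)
                  ; (inj₁ p) (inj₂ (refl , _)) → inj₁ p
                  ; (inj₂ (refl , _)) (inj₁ q) → inj₁ q
                  ; (inj₂ (refl , p)) (inj₂ (refl , q)) → inj₂ (refl , M.trans⊏ p q) }
    ; compare = cmp
    }
    where
    module L = StrictLinear L
    module M = StrictLinear M
    cmp : ∀ u v → Lex R S u v ⊎ u ≡ v ⊎ Lex R S v u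
    cmp (x , y) (x' , y') with L.compare x x' | M.compare y y'
    ... | inj₁ p           | _                = inj₁ (inj₁ p)
    ... | inj₂ (inj₂ p)    | _                = inj₂ (inj₂ (inj₁ p))
    ... | inj₂ (inj₁ refl) | inj₁ q           = inj₁ (inj₂ (refl , q))
    ... | inj₂ (inj₁ refl) | inj₂ (inj₁ refl) = inj₂ (inj₁ refl)
    ... | inj₂ (inj₁ refl) | inj₂ (inj₂ q)    = inj₂ (inj₂ (inj₂ (refl , q)))

  converse-linear : StrictLinear R → StrictLinear (λ x y → R y x)
  converse-linear L = record
    { irrefl⊏ = L.irrefl⊏
    ; trans⊏  = λ p q → L.trans⊏ q p
    ; compare = λ x y → L.compare y x |> λ
        { (inj₁ p) → inj₁ p ; (inj₂ (inj₁ e)) → inj₂ (inj₁ (sym e)) ; (inj₂ (inj₂ p)) → inj₂ (inj₂ p) }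
    }
    where
    module L = StrictLinear L
    open import Function using (_|>_)

  injective-linear : ∀ {Y : Set} (h : Y → X) → (∀ {x y} → h x ≡ h y → x ≡ y) →
                     StrictLinear R → StrictLinear (λ x y → R (h x) (h y))
  injective-linear {Y} h inj L = record
    { irrefl⊏ = L.irrefl⊏
    ; trans⊏  = L.trans⊏
    ; compare = cmp
    }
    where
    module L = StrictLinear L
    cmp : ∀ x y → R (h x) (h y) ⊎ x ≡ y ⊎ R (h y) (h x)
    cmp x y with L.compare (h x) (h y)
    ... | inj₁ p        = inj₁ p
    ... | inj₂ (inj₁ e) = inj₂ (inj₁ (inj e))
    ... | inj₂ (inj₂ p) = inj₂ (inj₂ p)

ℕ-linear : StrictLinear _<_
ℕ-linear = record { irrefl⊏ = <-irrefl refl ; trans⊏ = <-trans ; compare = cmp }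
  where
  cmp : ∀ x y → x < y ⊎ x ≡ y ⊎ y < x
  cmp x y with <-cmp x y
  ... | tri< p _ _ = inj₁ p
  ... | tri≈ _ p _ = inj₂ (inj₁ p)
  ... | tri> _ _ p = inj₂ (inj₂ p)

ℚ-linear : StrictLinear ℚ._<_
ℚ-linear = record { irrefl⊏ = ℚ.<-irrefl refl ; trans⊏ = ℚ.<-trans ; compare = cmp }
  where
  cmp : ∀ x y → x ℚ.< y ⊎ x ≡ y ⊎ y ℚ.< x
  cmp x y with ℚ.<-cmp x y
  ... | tri< p _ _ = inj₁ p
  ... | tri≈ _ p _ = inj₂ (inj₁ p)
  ... | tri> _ _ p = inj₂ (inj₂ p)

-- Ties are broken by the natural order, so the points sharing a key form an ω-sequence if there are
-- infinitely many of them.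
module Keyed {X : Set} {_⊏_ : X → X → Set} (L : StrictLinear _⊏_) (K : ℕ → X) where

  infix 4 _≺_
  _≺_ : ℕ → ℕ → Set
  e ≺ e' = Lex _⊏_ _<_ (K e , e) (K e' , e')

  ≺-linear : StrictLinear _≺_
  ≺-linear = injective-linear (λ e → K e , e) (cong proj₂) (lex-linear L ℕ-linear)

-- The copy N with primitive recursive ≪

module Standard where
  open Keyed ℚ-linear val public
  private module D = DenseOrder ℚ-denseOrder

  standard-blocks : Blocks _≺_
  standard-blocks = record
    { linear  = ≺-linear
    ; _≪_     = λ x y → val x ℚ.< val y
    ; ≪-dense = record
      { asym    = D.asym
      ; cotrans = λ z → D.cotrans (val z)
      ; dense   = λ {x} {y} l → let r , a , b = D.dense l ; e , v = val-surjective r in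
                    e , subst (val x ℚ.<_) (sym v) a , subst (ℚ._< val y) (sym v) b
      ; upper   = λ x → let r , a = D.upper (val x) ; e , v = val-surjective r in e , subst (val x ℚ.<_) (sym v) a
      ; lower   = λ x → let r , a = D.lower (val x) ; e , v = val-surjective r in e , subst (ℚ._< val x) (sym v) a
      }
    ; ≪⇒⊏      = inj₁
    ; bounded  = λ x → x , λ z l n → case l of λ where
        (inj₁ p)       → ⊥-elim (n p)
        (inj₂ (_ , p)) → p
    -- The same rational under a larger padding component, hence a later point of the block.
    ; unending = λ x → ⟨ suc x , π₂ x ⟩ ,
        inj₂ (sym (val-repeats x (suc x)) , fst≤pair (suc x) (π₂ x)) ,
        λ l → ℚ.<-irrefl (sym (val-repeats x (suc x))) l
    }

  standard : Σ Punctual λ A → ∀ x y → Rel A x y ⟺ x ≺ y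
  standard = punctual (val<ᵈ (var 0F) (var 1F) ⊎ᵈ val≡ᵈ (var 0F) (var 1F) ×ᵈ (var 0F <ᵈ var 1F))

-- Ranks: non-negative rationals with repetitions

bottom : ℚ
bottom = frac 0 0 0

-- The first component of `m` is padding. Negative values are left out so that every level has a
-- least key, which holds its marker and, on level 0, takes in the collapsed points.
rank : ℕ → ℚ
rank m = frac (π₁ (π₂ m)) 0 (π₂ (π₂ m))

NonNegative : ℚ → Set
NonNegative r = ¬ r ℚ.< bottom

rank-nonNegative : ∀ m → NonNegative (rank m)
rank-nonNegative m l = n≮0 (subst (π₁ (π₂ m) * 1 + 0 * suc (π₂ (π₂ m)) <_) refl
  (proj₁ (frac-< (π₁ (π₂ m)) 0 (π₂ (π₂ m)) 0 0 0) l))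

π₁-zero : π₁ 0 ≡ 0
π₁-zero = n≤0⇒n≡0 (subst (π₁ 0 ≤_) (pair-π 0) (fst≤pair (π₁ 0) (π₂ 0)))

π₂-zero : π₂ 0 ≡ 0
π₂-zero = n≤0⇒n≡0 (subst (π₂ 0 ≤_) (pair-π 0) (snd≤pair (π₁ 0) (π₂ 0)))

rank-zero : rank 0 ≡ bottom
rank-zero rewrite π₂-zero | π₁-zero | π₂-zero = refl

rank-unbounded : ∀ {r} → NonNegative r → ∀ n → ∃ λ m → n ≤ m × rank m ≡ r
rank-unbounded {r} nn n with frac-nonNegative r nn
... | a , c , e = ⟨ n , ⟨ a , c ⟩ ⟩ , fst≤pair n ⟨ a , c ⟩ , trans (code a c) e
  where
  code : ∀ a c → rank ⟨ n , ⟨ a , c ⟩ ⟩ ≡ frac a 0 c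
  code a c rewrite π₂-pair n ⟨ a , c ⟩ | π₁-pair a c | π₂-pair a c = refl

rank<ᵈ : ∀ {g n} {F G : Vec ℕ n → ℕ} → PrimRec g F → PrimRec g G →
         Decᵖ g (λ xs → rank (F xs) ℚ.< rank (G xs))
rank<ᵈ p q = frac<ᵈ (π₁ᵖ (π₂ᵖ p)) (const 0) (π₂ᵖ (π₂ᵖ p)) (π₁ᵖ (π₂ᵖ q)) (const 0) (π₂ᵖ (π₂ᵖ q))

rank≡ᵈ : ∀ {g n} {F G : Vec ℕ n → ℕ} → PrimRec g F → PrimRec g G →
         Decᵖ g (λ xs → rank (F xs) ≡ rank (G xs))
rank≡ᵈ p q = equivᵈ (λ xs → ≡⟺≮×≯) ((¬ᵈ rank<ᵈ p q) ×ᵈ (¬ᵈ rank<ᵈ q p))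

-- Π₂ conditions as counters

-- A Π₂ condition ∀ b ∃ c G b c holds iff the counter below, which waits at b until a c with
-- G b c has shown up, is increased infinitely often.
module Counter (em : ExcludedMiddle 0ℓ) {G : Vec ℕ 4 → Set} (Gᵈ : Decᵖ zero-oracle G) where
  open Classical em

  private
    FiresAt : Vec ℕ 4 → Set
    FiresAt xs = ∃ λ c → c ≤ lookup xs 3F × G (lookup xs 0F ∷ lookup xs 1F ∷ lookup xs 2F ∷ c ∷ [])

  opaque
    firesᵈ : Decᵖ zero-oracle FiresAt
    firesᵈ = ∃≤ᵈ (subᵈ Gᵈ (var 1F ∷ᵖ var 2F ∷ᵖ var 3F ∷ᵖ var 0F ∷ᵖ []ᵖ)) (var 3F)

    fireχ : Vec ℕ 4 → ℕ
    fireχ = Decᵖ.char firesᵈ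

    fireχᵖ : PrimRec zero-oracle fireχ
    fireχᵖ = Decᵖ.prim firesᵈ

    fireχ-sound : ∀ x k b t → FiresAt (x ∷ k ∷ b ∷ t ∷ []) ⟺ fireχ (x ∷ k ∷ b ∷ t ∷ []) ≡ 0
    fireχ-sound x k b t = Decᵖ.sound firesᵈ (x ∷ k ∷ b ∷ t ∷ [])

  counter : ℕ → ℕ → ℕ → ℕ
  counter x k = natRec 0 (λ t r → ifZero (fireχ (x ∷ k ∷ r ∷ t ∷ [])) (suc r) r)

  Fires : ℕ → ℕ → ℕ → Set
  Fires x k t = ∃ λ c → c ≤ t × G (x ∷ k ∷ counter x k t ∷ c ∷ [])

  counterᵖ : PrimRec zero-oracle {3} (λ xs → counter (lookup xs 0F) (lookup xs 1F) (lookup xs 2F))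
  counterᵖ = recᵖ (const 0)
    (ifZeroᵖ (sub fireχᵖ (var 2F ∷ᵖ var 3F ∷ᵖ var 1F ∷ᵖ var 0F ∷ᵖ []ᵖ))
      (sucᵖ (var 1F)) (var 1F)) (var 2F)

  Big : ℕ → ℕ → Set
  Big x k = ∀ b → ∃ λ c → G (x ∷ k ∷ b ∷ c ∷ [])

  module _ (x k : ℕ) where

    counter-fires : ∀ {t} → Fires x k t → counter x k (suc t) ≡ suc (counter x k t)
    counter-fires {t} f = cong (λ χ → ifZero χ (suc (counter x k t)) (counter x k t))
      (proj₁ (fireχ-sound x k (counter x k t) t) f)

    counter-waits : ∀ {t} → ¬ Fires x k t → counter x k (suc t) ≡ counter x k t
    counter-waits {t} nf with fireχ (x ∷ k ∷ counter x k t ∷ t ∷ []) in eq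
    ... | zero  = ⊥-elim (nf (proj₂ (fireχ-sound x k (counter x k t) t) eq))
    ... | suc _ = refl

    counter-suc : ∀ t → counter x k t ≤ counter x k (suc t) × counter x k (suc t) ≤ suc (counter x k t)
    counter-suc t with em {Fires x k t}
    ... | yes f = subst (counter x k t ≤_) (sym (counter-fires f)) (n≤1+n _) , ≤-reflexive (counter-fires f)
    ... | no nf = ≤-reflexive (sym (counter-waits nf)) , subst (_≤ suc (counter x k t)) (sym (counter-waits nf)) (n≤1+n _)

    counter-mono : ∀ {s t} → s ≤ t → counter x k s ≤ counter x k t
    counter-mono {s} {zero}  z≤n = ≤-refl
    counter-mono {s} {suc t} le with m≤n⇒m<n∨m≡n le
    ... | inj₁ lt   = ≤-trans (counter-mono (≤-pred lt)) (proj₁ (counter-suc t))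
    ... | inj₂ refl = ≤-refl

    counter≤ : ∀ t → counter x k t ≤ t
    counter≤ zero    = z≤n
    counter≤ (suc t) = ≤-trans (proj₂ (counter-suc t)) (s≤s (counter≤ t))

    -- After the counter reaches `m`, a witness `c` for `m` comes within the search bound in at most
    -- `c` stages.
    big⇒fires : Big x k → ∀ m → ∃ λ t → Fires x k t × counter x k t ≡ m
    big⇒fires big = go
      where
      waitFrom : ∀ m t₀ → counter x k t₀ ≡ m → ∀ n →
                 (∃ λ t → Fires x k t × counter x k t ≡ m) ⊎ counter x k (n + t₀) ≡ m
      waitFrom m t₀ e zero = inj₂ e
      waitFrom m t₀ e (suc n) with waitFrom m t₀ e n
      ... | inj₁ w = inj₁ w
      ... | inj₂ e' with em {Fires x k (n + t₀)}
      ...   | yes f = inj₁ (n + t₀ , f , e')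
      ...   | no nf = inj₂ (trans (counter-waits nf) e')
      reach : ∀ m t₀ → counter x k t₀ ≡ m → ∃ λ t → Fires x k t × counter x k t ≡ m
      reach m t₀ e with big m
      ... | c , g with waitFrom m t₀ e c
      ...   | inj₁ w  = w
      ...   | inj₂ e' = c + t₀ , (c , m≤m+n c t₀ , subst (λ b → G (x ∷ k ∷ b ∷ c ∷ [])) (sym e') g) , e'
      go : ∀ m → ∃ λ t → Fires x k t × counter x k t ≡ m
      go zero = reach 0 0 refl
      go (suc m) with go m
      ... | t , f , e = reach (suc m) (suc t) (trans (counter-fires f) (cong suc e))

    -- The counter never passes a `b` without witness, and it leaves each value below `b` at most
    -- once.
    ¬big⇒fires-bounded : ¬ Big x k → ∃ λ T → ∀ t → Fires x k t → t < T
    ¬big⇒fires-bounded nb with ¬∀⇒∃¬ nb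
    ... | b , none with uniformBound {λ m T → ∀ t → Fires x k t → counter x k t ≡ m → t < T} b
                          (λ le f t p e → <-≤-trans (f t p e) le) (λ m _ → at m)
      where
      at : ∀ m → ∃ λ T → ∀ t → Fires x k t → counter x k t ≡ m → t < T
      at m with em {∃ λ t → Fires x k t × counter x k t ≡ m}
      ... | no no-fire = 0 , λ t f e → ⊥-elim (no-fire (t , f , e))
      ... | yes (t , f , e) = suc t , λ t' f' e' → s≤s (≮⇒≥ λ t<t' →
          <-irrefl refl (<-≤-trans (≤-reflexive (trans (cong suc (trans e' (sym e))) (sym (counter-fires f))))
                                   (counter-mono t<t')))
    ... | T , bd = T , λ t f → bd (counter x k t) (≤∧≢⇒< (capped t) (not-b f)) t f refl
      where
      not-b : ∀ {t} → Fires x k t → ¬ counter x k t ≡ b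
      not-b (c , _ , g) refl = none (c , g)
      capped : ∀ t → counter x k t ≤ b
      capped zero = z≤n
      capped (suc t) with em {Fires x k t}
      ... | yes f = subst (_≤ b) (sym (counter-fires f)) (≤∧≢⇒< (capped t) (not-b f))
      ... | no nf = subst (_≤ b) (sym (counter-waits nf)) (capped t)

-- Keys, and their collapse to blocks

Key : Set
Key = ℕ × ℕ × ℚ

infix 4 _⊏_
-- Levels descend: level k + 1 lies directly below level k and fills the interval between the
-- markers at the bottoms of the two.
_⊏_ : Key → Key → Set
_⊏_ = Lex _<_ (Lex _>_ ℚ._<_)

⊏-linear : StrictLinear _⊏_
⊏-linear = lex-linear ℕ-linear (lex-linear (converse-linear ℕ-linear) ℚ-linear)

-- Levels 1, …, k₀ x receive only finitely many points, which join the first block of level 0.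
module Collapse (k₀ : ℕ → ℕ) where
  open StrictLinear ⊏-linear

  Small : ℕ → ℕ → Set
  Small x k = 0 < k × k ≤ k₀ x

  small? : ∀ x k → Dec (Small x k)
  small? x k = (0 <? k) ×-dec (k ≤? k₀ x)

  opaque
    collapse : Key → Key
    collapse (x , k , r) with small? x k
    ... | yes _ = x , 0 , bottom
    ... | no  _ = x , k , r

    collapse-small : ∀ {x k r} → Small x k → collapse (x , k , r) ≡ (x , 0 , bottom)
    collapse-small {x} {k} s with small? x k
    ... | yes _ = refl
    ... | no ns = ⊥-elim (ns s)

    collapse-fixed : ∀ {x k r} → ¬ Small x k → collapse (x , k , r) ≡ (x , k , r)
    collapse-fixed {x} {k} ns with small? x k
    ... | yes s = ⊥-elim (ns s)
    ... | no _  = refl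

    collapse-proj₁ : ∀ u → proj₁ (collapse u) ≡ proj₁ u
    collapse-proj₁ (x , k , r) with small? x k
    ... | yes _ = refl
    ... | no  _ = refl

  -- The names of blocks; `collapse` retracts the keys of non-negative rank onto them.
  Valid : Key → Set
  Valid (x , k , r) = ¬ Small x k × NonNegative r

  opaque
    unfolding collapse

    collapse-valid : ∀ u → NonNegative (proj₂ (proj₂ u)) → Valid (collapse u)
    collapse-valid (x , k , r) nn with small? x k
    ... | yes _ = (λ { (() , _) }) , ℚ.<-irrefl refl
    ... | no ns = ns , nn

    -- Small levels lie below level 0 and above all levels beyond `k₀ x`, and `bottom` is least in
    -- level 0; so moving them there reverses no pair.
    collapse-mono : ∀ u v → NonNegative (proj₂ (proj₂ v)) → u ⊏ v → ¬ collapse v ⊏ collapse u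
    collapse-mono u v _ (inj₁ l) (inj₁ l') =
      <-asym l (subst₂ _<_ (collapse-proj₁ v) (collapse-proj₁ u) l')
    collapse-mono u v _ (inj₁ l) (inj₂ (e , _)) =
      <-irrefl (trans (sym (collapse-proj₁ u)) (trans (sym e) (collapse-proj₁ v))) l
    collapse-mono (x , k , r) (x , k' , r') nn (inj₂ (refl , p)) q with small? x k | small? x k'
    ... | yes _ | yes _ = irrefl⊏ {x , 0 , bottom} q
    ... | no _  | no _  = asym⊏ {x , k , r} {x , k' , r'} (inj₂ (refl , p)) q
    ... | yes s | no ns = case q of λ
      { (inj₁ l)                     → <-irrefl refl l
      ; (inj₂ (_ , inj₁ l))          → ns (l , ≤-trans (level≤ p) (proj₂ s))
      ; (inj₂ (_ , inj₂ (refl , l))) → nn l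
      }
      where
      level≤ : Lex _>_ ℚ._<_ (k , r) (k' , r') → k' ≤ k
      level≤ (inj₁ l)          = <⇒≤ l
      level≤ (inj₂ (refl , _)) = ≤-refl
    ... | no ns | yes s = case q of λ where
      (inj₁ l)                     → <-irrefl refl l
      (inj₂ (_ , inj₁ ()))
      (inj₂ (_ , inj₂ (refl , _))) → case p of λ where
        (inj₁ ())
        (inj₂ (refl , _)) → ns s

    collapse-of-valid : ∀ {u} → Valid u → collapse u ≡ u
    collapse-of-valid (ns , _) = collapse-fixed ns

-- The copy C

module Coding (em : ExcludedMiddle 0ℓ) {G : Vec ℕ 4 → Set} (Gᵈ : Decᵖ zero-oracle G) (k₀ : ℕ → ℕ)
              (start : ∀ x k → G (x ∷ k ∷ 0 ∷ 0 ∷ [])) where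
  open Classical em
  open Counter em Gᵈ public
  open Collapse k₀ public

  -- If stage t fires, point x k t is placed at level k by the rank of the current counter value.
  -- Otherwise it is discarded into the first block of level 0, which is infinite anyway.
  point : ℕ → ℕ → ℕ → ℕ
  point x k t = ⟨ x , ⟨ k , t ⟩ ⟩

  X κ T : ℕ → ℕ
  X e = π₁ e
  κ e = π₁ (π₂ e)
  T e = π₂ (π₂ e)

  opaque
    χ : ℕ → ℕ
    χ e = fireχ (X e ∷ κ e ∷ counter (X e) (κ e) (T e) ∷ T e ∷ [])

    level code : ℕ → ℕ
    level e = ifZero (χ e) (κ e) 0
    code  e = ifZero (χ e) (counter (X e) (κ e) (T e)) 0

  K : ℕ → Key
  K e = X e , level e , rank (code e)

  opaque
    unfolding χ level code

    K-fires : ∀ {e x k t} → X e ≡ x → κ e ≡ k → T e ≡ t → Fires x k t →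
              K e ≡ (x , k , rank (counter x k t))
    K-fires {e} refl refl refl f rewrite proj₁ (fireχ-sound (X e) (κ e) (counter (X e) (κ e) (T e)) (T e)) f = refl

    K-waits : ∀ {e} → ¬ Fires (X e) (κ e) (T e) → level e ≡ 0
    K-waits {e} nf with χ e in eq
    ... | zero  = ⊥-elim (nf (proj₂ (fireχ-sound (X e) (κ e) (counter (X e) (κ e) (T e)) (T e)) eq))
    ... | suc _ = refl

  module _ {x k t : ℕ} where

    X-point : X (point x k t) ≡ x
    X-point = π₁-pair x ⟨ k , t ⟩

    κ-point : κ (point x k t) ≡ k
    κ-point = trans (cong π₁ (π₂-pair x ⟨ k , t ⟩)) (π₁-pair k t)

    T-point : T (point x k t) ≡ t
    T-point = trans (cong π₂ (π₂-pair x ⟨ k , t ⟩)) (π₂-pair k t)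

  point-eta : ∀ e → point (X e) (κ e) (T e) ≡ e
  point-eta e = trans (cong (λ s → ⟨ X e , s ⟩) (pair-π (π₂ e))) (pair-π e)

  K-point : ∀ {x k t} → Fires x k t → K (point x k t) ≡ (x , k , rank (counter x k t))
  K-point = K-fires X-point κ-point T-point

  -- By `start` every level fires at stage 0, so each marker sits at the bottom of its level whether
  -- or not the level is big.
  K-start : ∀ x k → K (point x k 0) ≡ (x , k , bottom)
  K-start x k = trans (K-point (0 , z≤n , start x k)) (cong (λ r → x , k , r) rank-zero)

  module _ (i : Fin 2) where

    Xᵖ : PrimRec zero-oracle {2} (λ xs → X (lookup xs i))
    Xᵖ = π₁ᵖ (var i)
    κᵖ : PrimRec zero-oracle {2} (λ xs → κ (lookup xs i))
    κᵖ = π₁ᵖ (π₂ᵖ (var i))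
    Tᵖ : PrimRec zero-oracle {2} (λ xs → T (lookup xs i))
    Tᵖ = π₂ᵖ (π₂ᵖ (var i))
    countᵖ : PrimRec zero-oracle {2} (λ xs → let e = lookup xs i in counter (X e) (κ e) (T e))
    countᵖ = sub counterᵖ (Xᵖ ∷ᵖ κᵖ ∷ᵖ Tᵖ ∷ᵖ []ᵖ)

    opaque
      unfolding χ level code

      χᵖ : PrimRec zero-oracle {2} (λ xs → χ (lookup xs i))
      χᵖ = sub (fireχᵖ) (Xᵖ ∷ᵖ κᵖ ∷ᵖ countᵖ ∷ᵖ Tᵖ ∷ᵖ []ᵖ)
      levelᵖ : PrimRec zero-oracle {2} (λ xs → level (lookup xs i))
      levelᵖ = ifZeroᵖ χᵖ κᵖ (const 0)
      codeᵖ : PrimRec zero-oracle {2} (λ xs → code (lookup xs i))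
      codeᵖ = ifZeroᵖ χᵖ countᵖ (const 0)

  open Keyed ⊏-linear K public

  coded : Σ Punctual λ C → ∀ x y → Rel C x y ⟺ x ≺ y
  coded = punctual ((Xᵖ 0F <ᵈ Xᵖ 1F ⊎ᵈ (Xᵖ 0F ≡ᵈ Xᵖ 1F) ×ᵈ
      ((levelᵖ 1F <ᵈ levelᵖ 0F) ⊎ᵈ (levelᵖ 0F ≡ᵈ levelᵖ 1F) ×ᵈ rank<ᵈ (codeᵖ 0F) (codeᵖ 1F)))
    ⊎ᵈ (equivᵈ (λ xs → (λ (a , b , c) → cong₂ _,_ a (cong₂ _,_ b c)) ,
                       (λ e → cong proj₁ e , cong (proj₁ ∘ proj₂) e , cong (proj₂ ∘ proj₂) e))
          ((Xᵖ 0F ≡ᵈ Xᵖ 1F) ×ᵈ (levelᵖ 0F ≡ᵈ levelᵖ 1F) ×ᵈ rank≡ᵈ (codeᵖ 0F) (codeᵖ 1F)))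
       ×ᵈ (var 0F <ᵈ var 1F))

  module _ (small : ∀ {x k} → Small x k → ¬ Big x k) (big : ∀ {x k} → ¬ Small x k → Big x k) where

    -- A non-negative rational is the rank of arbitrarily large `m`, and the counter of a big level
    -- fires at each `m`. Since `m ≤ t`, the resulting points are large as well.
    attained : ∀ {u} → Valid u → ∀ n → ∃ λ e → n ≤ e × K e ≡ u
    attained {x , k , r} (ns , nn) n =
      let m , n≤m , rank≡ = rank-unbounded nn n
          t , f , count≡  = big⇒fires x k (big ns) m
      in point x k t ,
         ≤-trans n≤m (≤-trans (≤-reflexive (sym count≡)) (≤-trans (counter≤ x k t)
           (≤-trans (snd≤pair k t) (snd≤pair x ⟨ k , t ⟩)))) ,
         trans (K-point f) (cong (λ r → x , k , r) (trans (cong rank count≡) rank≡))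

    K′ : ℕ → Key
    K′ e = collapse (K e)

    K-nonNegative : ∀ e → NonNegative (proj₂ (proj₂ (K e)))
    K-nonNegative e = rank-nonNegative (code e)

    K′-valid : ∀ e → Valid (K′ e)
    K′-valid e = collapse-valid (K e) (K-nonNegative e)

    attained′ : ∀ {u} → Valid u → ∃ λ e → K′ e ≡ u
    attained′ v with attained v 0
    ... | e , _ , eq = e , trans (cong collapse eq) (collapse-of-valid v)

    private
      module L = StrictLinear ⊏-linear
      module D = DenseOrder ℚ-denseOrder

    _≪_ : ℕ → ℕ → Set
    e ≪ e' = K′ e ⊏ K′ e'

    nonNegative-above : ∀ {r s} → NonNegative r → r ℚ.< s → NonNegative s
    nonNegative-above nn l l' = nn (ℚ.<-trans l l')

    valid-dense : ∀ {u v} → Valid u → u ⊏ v → ∃ λ w → Valid w × u ⊏ w × w ⊏ v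
    valid-dense {x , k , r} (ns , nn) (inj₁ l) =
      let r' , a = D.upper r in (x , k , r') , (ns , nonNegative-above nn a) , inj₂ (refl , inj₂ (refl , a)) , inj₁ l
    valid-dense {x , k , r} (ns , nn) (inj₂ (refl , inj₁ l)) =
      let r' , a = D.upper r in (x , k , r') , (ns , nonNegative-above nn a) , inj₂ (refl , inj₂ (refl , a)) , inj₂ (refl , inj₁ l)
    valid-dense {x , k , r} (ns , nn) (inj₂ (refl , inj₂ (refl , l))) =
      let r' , a , b = ℚ.<-dense l in
      (x , k , r') , (ns , nonNegative-above nn a) , inj₂ (refl , inj₂ (refl , a)) , inj₂ (refl , inj₂ (refl , b))

    valid-upper : ∀ {u} → Valid u → ∃ λ w → Valid w × u ⊏ w
    valid-upper {x , k , r} (ns , nn) =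
      let r' , a = D.upper r in (x , k , r') , (ns , nonNegative-above nn a) , inj₂ (refl , inj₂ (refl , a))

    valid-lower : ∀ {u} → Valid u → ∃ λ w → Valid w × w ⊏ u
    -- A level beyond both `k` and `k₀ x` is lower in the order and not small.
    valid-lower {x , k , r} _ = (x , suc (k + k₀ x) , bottom) ,
      ((λ (_ , le) → <-irrefl refl (≤-trans (s≤s (m≤n+m (k₀ x) k)) le)) , ℚ.<-irrefl refl) ,
      inj₂ (refl , inj₁ (s≤s (m≤m+n k (k₀ x))))

    ≪-dense : DenseOrder _≪_
    ≪-dense = record
      { asym    = L.asym⊏
      ; cotrans = λ z → L.cotrans⊏ (K′ z)
      ; dense   = λ {x} {y} l → let w , v , a , b = valid-dense (K′-valid x) l ; e , eq = attained′ v in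
                    e , subst (K′ x ⊏_) (sym eq) a , subst (_⊏ K′ y) (sym eq) b
      ; upper   = λ x → let w , v , a = valid-upper (K′-valid x) ; e , eq = attained′ v in e , subst (K′ x ⊏_) (sym eq) a
      ; lower   = λ x → let w , v , a = valid-lower (K′-valid x) ; e , eq = attained′ v in e , subst (_⊏ K′ x) (sym eq) a
      }

    ≪⇒≺ : ∀ {e e'} → e ≪ e' → e ≺ e'
    ≪⇒≺ {e} {e'} l with L.compare (K e) (K e')
    ... | inj₁ p        = inj₁ p
    ... | inj₂ (inj₁ p) = ⊥-elim (L.irrefl⊏ (subst (K′ e ⊏_) (cong collapse (sym p)) l))
    ... | inj₂ (inj₂ p) = ⊥-elim (collapse-mono (K e') (K e) (K-nonNegative e) p l)

    -- Different keys share a block only through `collapse`, and the lower of them cannot be the key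
    -- that names the block, as that one lies above all the collapsed ones.
    merged : ∀ z e → K z ⊏ K e → ¬ z ≪ e → X z ≡ X e × Small (X z) (level z)
    merged z e l n with L.connected n (collapse-mono (K z) (K e) (K-nonNegative e) l)
    ... | eq = X≡ , byContradiction not-fixed
      where
      X≡ : X z ≡ X e
      X≡ = trans (sym (collapse-proj₁ (K z))) (trans (cong proj₁ eq) (collapse-proj₁ (K e)))
      not-fixed : ¬ ¬ Small (X z) (level z)
      not-fixed ns with small? (X e) (level e)
      ... | no ns' = L.irrefl⊏ {K z} (subst (K z ⊏_) (trans (sym (collapse-fixed ns')) (trans (sym eq) (collapse-fixed ns))) l)
      ... | yes s with trans (sym (collapse-fixed ns)) (trans eq (collapse-small s))
      ...   | Kz≡ with subst (_⊏ K e) Kz≡ l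
      ...     | inj₁ l'                = <-irrefl refl l'
      ...     | inj₂ (_ , inj₁ ())
      ...     | inj₂ (_ , inj₂ (0≡ , _)) = <-irrefl 0≡ (proj₁ s)

    -- Stages that do not fire put their points on level 0, and the finitely many small levels fire
    -- finitely often.
    small-bounded : ∀ x → ∃ λ b → ∀ z → X z ≡ x → Small x (level z) → z < b
    small-bounded x with uniformBound {λ k B → Small x k → ∀ t → Fires x k t → t < B} (suc (k₀ x))
                           (λ le f s t q → <-≤-trans (f s t q) le) (λ k _ → fires-bound k)
      where
      fires-bound : ∀ k → ∃ λ B → Small x k → ∀ t → Fires x k t → t < B
      fires-bound k with small? x k
      ... | yes s = let B , f = ¬big⇒fires-bounded x k (small s) in B , λ _ → f
      ... | no ns = 0 , λ s → ⊥-elim (ns s)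
    ... | B , fires< with uniformBound {λ k b → ∀ t → t < B → point x k t < b} (suc (k₀ x))
                            (λ le f t q → <-≤-trans (f t q) le) (λ k _ → maximum (point x k) B)
    ...   | b , point< = b , λ z X≡ s → bound z X≡ s
      where
      bound : ∀ z → X z ≡ x → Small x (level z) → z < b
      bound z refl s with em {Fires (X z) (κ z) (T z)}
      ... | no nf = ⊥-elim (<-irrefl (sym (K-waits nf)) (proj₁ s))
      ... | yes f = subst (_< b) (point-eta z) (point< (κ z) (s≤s (proj₂ s′)) (T z) (fires< (κ z) (s≤s (proj₂ s′)) s′ (T z) f))
        where
        s′ : Small (X z) (κ z)
        s′ = subst (Small (X z)) (cong (proj₁ ∘ proj₂) (K-fires {z} refl refl refl f)) s

    coded-blocks : Blocks _≺_
    coded-blocks = record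
      { linear   = ≺-linear
      ; _≪_      = _≪_
      ; ≪-dense  = ≪-dense
      ; ≪⇒⊏      = ≪⇒≺
      ; bounded  = bounded
      ; unending = unending
      }
      where
      bounded : ∀ e → ∃ λ b → ∀ z → z ≺ e → ¬ z ≪ e → z < b
      bounded e with small-bounded (X e)
      ... | b , bd = e ⊔ b , λ where
        z (inj₁ l) n       → let X≡ , s = merged z e l n in
          <-≤-trans (bd z X≡ (subst (λ x → Small x (level z)) X≡ s)) (m≤n⊔m e b)
        z (inj₂ (_ , l)) _ → <-≤-trans l (m≤m⊔n e b)
      unending : ∀ e → ∃ λ e' → e ≺ e' × ¬ e ≪ e'
      -- A later number whose key names the block: it is larger by the tie-break, or by its key if
      -- `e` was collapsed.
      unending e with attained (K′-valid e) (suc e)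
      ... | e' , e<e' , eq = e' , above (small? (X e) (level e)) ,
          λ l → L.irrefl⊏ (subst (K′ e ⊏_) (trans (cong collapse eq) (collapse-of-valid (K′-valid e))) l)
        where
        above : Dec (Small (X e) (level e)) → e ≺ e'
        above (no ns) = inj₂ (trans (sym (collapse-fixed ns)) (sym eq) , e<e')
        above (yes s) = inj₁ (subst (K e ⊏_) (trans (sym (collapse-small s)) (sym eq)) (inj₂ (refl , inj₁ (proj₁ s))))

-- Invariance of ≪ under isomorphism

equiv-blocks : ∀ {_⊏_ _⊏'_ : ℕ → ℕ → Set} → (∀ x y → x ⊏' y ⟺ x ⊏ y) → Blocks _⊏_ → Blocks _⊏'_
equiv-blocks e B = record
  { linear   = record
    { irrefl⊏ = λ {x} → irrefl⊏ ∘ proj₁ (e x x)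
    ; trans⊏  = λ {x} {y} {z} p q → proj₂ (e x z) (trans⊏ (proj₁ (e x y) p) (proj₁ (e y z) q))
    ; compare = λ x y → Sum.map (proj₂ (e x y)) (Sum.map₂ (proj₂ (e y x))) (compare x y)
    }
  ; _≪_      = _≪_
  ; ≪-dense  = ≪-dense
  ; ≪⇒⊏      = λ {x} {y} p → proj₂ (e x y) (≪⇒⊏ p)
  ; bounded  = λ x → let b , f = bounded x in b , λ z l → f z (proj₁ (e z x) l)
  ; unending = λ x → let y , l , n = unending x in y , proj₂ (e x y) l , n
  }
  where
  open Blocks B
  open StrictLinear linear

-- An isomorphism maps infinite intervals to infinite intervals.
≪-invariant : (em : ExcludedMiddle 0ℓ) {_⊏_ _⊏'_ : ℕ → ℕ → Set} (B : Blocks _⊏_) (B' : Blocks _⊏'_) (i : _⊏_ ≅ _⊏'_) →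
              ∀ {x y} → Blocks._≪_ B x y → Blocks._≪_ B' (to i x) (to i y)
≪-invariant em {_⊏_} {_⊏'_} B B' i {x} {y} p = proj₂ (BlockTheory.≪⟺unboundedly em B' _ _) λ b →
  let u , out     = maximum (from i) b
      c , u≤c , l , l' = proj₁ (BlockTheory.≪⟺unboundedly em B x y) p u
  in to i c ,
     ≮⇒≥ (λ lt → <-irrefl refl (<-≤-trans (subst (_< u) (from∘to i c) (out (to i c) lt)) u≤c)) ,
     proj₁ (pres i x c) l , proj₁ (pres i c y) l'

≤PR⇒PrimRec : ∀ {f g : ℕ → ℕ} {n} {F : Vec ℕ n → ℕ} → f ≤PR g → PrimRec g F → PrimRec g (f ∘ F)
≤PR⇒PrimRec {f} {F = F} (t , e) p = sub {F = λ xs → f (lookup xs 0F)} (primRec t λ { (x ∷ []) → e x }) (p ∷ᵖ []ᵖ)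

PrimRec⇒≤PR : ∀ {f g : ℕ → ℕ} → PrimRec g {1} (λ xs → f (lookup xs 0F)) → f ≤PR g
PrimRec⇒≤PR (primRec t c) = t , λ x → c (x ∷ [])

-- Recovering f from an isomorphism C → N

module Decoding (em : ExcludedMiddle 0ℓ) (f : ℕ → ℕ) (Σ3f : Σ3Graph f) where
  open Classical em

  private
    R = proj₁ Σ3f

  -- `j` codes a candidate value of `f x` together with an outer witness for it; `HasWitnesses` is
  -- the Π₂ condition W.
  Witness : ℕ → ℕ → ℕ → ℕ → Set
  Witness x j b c = evalPR R (x ∷ π₁ j ∷ π₂ j ∷ b ∷ c ∷ []) ≡ 0

  HasWitnesses : ℕ → ℕ → Set
  HasWitnesses x j = ∀ b → ∃ λ c → Witness x j b c

  opaque
    first-witness : ∀ x → LeastBelow (HasWitnesses x) ⟨ f x , proj₁ (proj₁ (proj₂ Σ3f x (f x)) refl) ⟩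
    first-witness x with proj₁ (proj₂ Σ3f x (f x)) refl
    ... | a , g = least (HasWitnesses x) λ b → let c , e = g b in c ,
      subst₂ (λ y a → evalPR R (x ∷ y ∷ a ∷ b ∷ c ∷ []) ≡ 0) (sym (π₁-pair (f x) a)) (sym (π₂-pair (f x) a)) e

  k₀ : ℕ → ℕ
  k₀ x = proj₁ (first-witness x)

  k₀-value : ∀ x → π₁ (k₀ x) ≡ f x
  k₀-value x = sym (proj₂ (proj₂ Σ3f x (π₁ (k₀ x))) (π₂ (k₀ x) , proj₁ (proj₂ (first-witness x))))

  -- For k > 0 the condition ∀ b ∃ c G x k b c expresses HasWitnesses x j for some j < k: a
  -- choice of counterexamples for all these j would be coded by some b.
  G : Vec ℕ 4 → Set
  G xs = lookup xs 1F ≡ 0 ⊎ lookup xs 2F ≡ 0 ⊎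
    (π₁ (lookup xs 3F) < lookup xs 1F ×
     Witness (lookup xs 0F) (π₁ (lookup xs 3F)) (entry (pred (lookup xs 2F)) (π₁ (lookup xs 3F))) (π₂ (lookup xs 3F)))

  Gᵈ : Decᵖ zero-oracle G
  Gᵈ = (var 1F ≡ᵈ const 0) ⊎ᵈ (var 2F ≡ᵈ const 0) ⊎ᵈ ((π₁ᵖ (var 3F) <ᵈ var 1F) ×ᵈ
    (sub (primRec R λ _ → refl) (var 0F ∷ᵖ π₁ᵖ (π₁ᵖ (var 3F)) ∷ᵖ π₂ᵖ (π₁ᵖ (var 3F)) ∷ᵖ
       entryᵖ (var 2F ∸ᵖ const 1) (π₁ᵖ (var 3F)) ∷ᵖ π₂ᵖ (var 3F) ∷ᵖ []ᵖ) ≡ᵈ const 0))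

  -- `start` is met by the disjunct for `b ≡ 0`; the genuine conditions are shifted to `b ≥ 1`,
  -- whence the `pred` in `G`.
  open Coding em Gᵈ k₀ (λ _ _ → inj₂ (inj₁ refl)) public

  -- Level 0 is big by the first disjunct of `G`. Beyond `k₀ x`, the index `k₀ x` itself answers
  -- every `b`, paired with its witness for the corresponding entry.
  big : ∀ {x k} → ¬ Small x k → Big x k
  big {x} {zero}  _  b       = 0 , inj₁ refl
  big {x} {suc k} _  zero    = 0 , inj₂ (inj₁ refl)
  big {x} {suc k} ns (suc b) with proj₁ (proj₂ (first-witness x)) (entry b (k₀ x))
  ... | c , w = ⟨ k₀ x , c ⟩ , inj₂ (inj₂
    (subst (_< suc k) (sym π₁≡) (s≤s (≮⇒≥ λ lt → ns (z<s , lt))) ,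
     subst₂ (λ j c → Witness x j (entry b j) c) (sym π₁≡) (sym (π₂-pair (k₀ x) c)) w))
    where
    π₁≡ = π₁-pair (k₀ x) c

  small : ∀ {x k} → Small x k → ¬ Big x k
  small {x} {k} (0<k , k≤) big with choose k counterexample
    where
    counterexample : ∀ j → j < k → ∃ λ b → ¬ ∃ λ c → Witness x j b c
    counterexample j j<k = ¬∀⇒∃¬ (proj₂ (proj₂ (proj₂ (first-witness x))) j (<-≤-trans j<k k≤))
  ... | h , none with encode h k
  ...   | b , entry≡ with big (suc b)
  ...     | d , inj₁ refl            = <-irrefl refl 0<k
  ...     | d , inj₂ (inj₂ (lt , w)) =
    none (π₁ d) lt (π₂ d , subst (λ b → Witness x (π₁ d) b (π₂ d)) (entry≡ (π₁ d) lt) w)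

  C : Punctual
  C = proj₁ coded

  C-blocks : Blocks (Rel C)
  C-blocks = equiv-blocks (proj₂ coded) (coded-blocks small big)

  marker : ℕ → ℕ → ℕ
  marker x j = point x j 0

  markers-merged : ∀ {x j} → j < k₀ x → collapse (K (marker x (suc j))) ≡ collapse (K (marker x j))
  markers-merged {x} {j} lt = trans (cong collapse (K-start x (suc j))) (trans (collapse-small (z<s , lt))
    (sym (trans (cong collapse (K-start x j)) (collapse-start j (<⇒≤ lt)))))
    where
    collapse-start : ∀ j → j ≤ k₀ x → collapse (x , j , bottom) ≡ (x , 0 , bottom)
    collapse-start zero    _  = collapse-fixed λ { (() , _) }
    collapse-start (suc j) le = collapse-small (z<s , le)

  marker-separated : ∀ x → Blocks._≪_ C-blocks (marker x (suc (k₀ x))) (marker x (k₀ x))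
  marker-separated x = subst₂ _⊏_
      (sym (trans (cong collapse (K-start x (suc (k₀ x)))) (collapse-fixed λ (_ , le) → <-irrefl refl le)))
      (sym (cong collapse (K-start x (k₀ x))))
      (below (small? x (k₀ x)))
    where
    below : Dec (Small x (k₀ x)) → (x , suc (k₀ x) , bottom) ⊏ collapse (x , k₀ x , bottom)
    below (yes s) = subst ((x , suc (k₀ x) , bottom) ⊏_) (sym (collapse-small s)) (inj₂ (refl , inj₁ z<s))
    below (no ns) = subst ((x , suc (k₀ x) , bottom) ⊏_) (sym (collapse-fixed ns)) (inj₂ (refl , inj₁ ≤-refl))

  marker-decreasing : ∀ x j → Rel C (marker x (suc j)) (marker x j)
  marker-decreasing x j = proj₂ (proj₂ coded _ _)
    (inj₁ (subst₂ _⊏_ (sym (K-start x (suc j))) (sym (K-start x j)) (inj₂ (refl , inj₁ ≤-refl))))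

  -- The images of the markers 0, …, k₀ x in the standard copy lie in one block, where the
  -- order is the natural one; so they are decreasing numbers and k₀ x is at most the first.
  module _ (i : Rel C ≅ Rel (proj₁ Standard.standard)) where
    private
      N-blocks = equiv-blocks (proj₂ Standard.standard) Standard.standard-blocks

    image : ℕ → ℕ → ℕ
    image x j = to i (marker x j)

    Separated : ℕ → ℕ → Set
    Separated x j = val (image x (suc j)) ℚ.< val (image x j)

    separated : ∀ x → Separated x (k₀ x)
    separated x = ≪-invariant em C-blocks N-blocks i (marker-separated x)

    not-separated : ∀ {x j} → j < k₀ x → ¬ Separated x j
    not-separated {x} {j} lt s = StrictLinear.irrefl⊏ ⊏-linear
      (subst (_⊏ collapse (K (marker x j))) (markers-merged lt)
        (subst₂ (Blocks._≪_ C-blocks) (from∘to i _) (from∘to i _) (≪-invariant em N-blocks C-blocks (≅-sym i) s)))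

    image-decreasing : ∀ {x j} → j < k₀ x → image x (suc j) < image x j
    image-decreasing {x} {j} lt with proj₁ (proj₂ Standard.standard _ _) (proj₁ (pres i _ _) (marker-decreasing x j))
    ... | inj₁ s       = ⊥-elim (not-separated lt s)
    ... | inj₂ (_ , l) = l

    k₀-bounded : ∀ x → k₀ x ≤ image x 0
    k₀-bounded x = ≤-trans (m≤n+m (k₀ x) _) (go (k₀ x) ≤-refl)
      where
      go : ∀ j → j ≤ k₀ x → image x j + j ≤ image x 0
      go zero    _  = ≤-reflexive (+-identityʳ _)
      go (suc j) lt = ≤-trans (≤-reflexive (+-suc _ j))
        (≤-trans (+-monoˡ-≤ j (image-decreasing lt)) (go j (<⇒≤ lt)))

    module _ {d : ℕ → ℕ} (i≤d : to i ≤PR d) where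

      markerᵖ : ∀ {n} {F H : Vec ℕ n → ℕ} → PrimRec d F → PrimRec d H → PrimRec d (λ xs → image (F xs) (H xs))
      markerᵖ p q = ≤PR⇒PrimRec i≤d (pairᵖ p (pairᵖ q (const 0)))

      opaque
        separatedᵈ : Decᵖ d {2} (λ xs → Separated (lookup xs 0F) (lookup xs 1F))
        separatedᵈ = val<ᵈ (markerᵖ (var 0F) (sucᵖ (var 1F))) (markerᵖ (var 0F) (var 1F))

        χˢ : Vec ℕ 2 → ℕ
        χˢ = Decᵖ.char separatedᵈ

        χˢᵖ : PrimRec d χˢ
        χˢᵖ = Decᵖ.prim separatedᵈ

        χˢ-separated : ∀ {x j} → Separated x j → χˢ (x ∷ j ∷ []) ≡ 0
        χˢ-separated {x} {j} = proj₁ (Decᵖ.sound separatedᵈ (x ∷ j ∷ []))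

        χˢ-merged : ∀ {x j} → ¬ Separated x j → ¬ χˢ (x ∷ j ∷ []) ≡ 0
        χˢ-merged {x} {j} ns e = ns (proj₂ (Decᵖ.sound separatedᵈ (x ∷ j ∷ [])) e)

      -- The search moves up while neighbouring images share a block and rests at the first
      -- separation, so any number of rounds from `k₀ x` on gives the same result.
      search : ℕ → ℕ → ℕ
      search x = natRec 0 (λ _ j → ifZero (χˢ (x ∷ j ∷ [])) j (suc j))

      searchᵖ : PrimRec d {1} (λ xs → search (lookup xs 0F) (image (lookup xs 0F) 0))
      searchᵖ = recᵖ (const 0)
        (ifZeroᵖ (sub χˢᵖ (var 2F ∷ᵖ var 1F ∷ᵖ []ᵖ)) (var 1F) (sucᵖ (var 1F)))
        (markerᵖ (var 0F) (const 0))

      search-correct : ∀ x n → k₀ x ≤ n → search x n ≡ k₀ x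
      search-correct x n le = subst (λ n → search x n ≡ k₀ x) (m∸n+n≡m le) (stay (n ∸ k₀ x))
        where
        next-search : ℕ → ℕ
        next-search j = ifZero (χˢ (x ∷ j ∷ [])) j (suc j)
        moves : ∀ j → ¬ χˢ (x ∷ j ∷ []) ≡ 0 → next-search j ≡ suc j
        moves j ne with χˢ (x ∷ j ∷ [])
        ... | zero  = ⊥-elim (ne refl)
        ... | suc _ = refl
        climb : ∀ j → j ≤ k₀ x → search x j ≡ j
        climb zero    _  = refl
        climb (suc j) lt = trans (cong next-search (climb j (<⇒≤ lt))) (moves j (χˢ-merged (not-separated lt)))
        stay : ∀ m → search x (m + k₀ x) ≡ k₀ x
        stay zero    = climb (k₀ x) ≤-refl
        stay (suc m) = trans (cong next-search (stay m))
          (cong (λ v → ifZero v (k₀ x) (suc (k₀ x))) (χˢ-separated (separated x)))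

      decode : f ≤PR d
      decode = PrimRec⇒≤PR (cast (λ { (x ∷ []) → trans (cong π₁ (search-correct x _ (k₀-bounded x))) (k₀-value x) }) (π₁ᵖ searchᵖ))

  -- Categoricity of `A` provides maps out of `A`; C → N is composed through `A`, which is where the
  -- bound on an inverse enters.
  decode-via : ∀ {d} (A : Punctual) (iN : Rel A ≅ Rel (proj₁ Standard.standard)) (iC : Rel A ≅ Rel C) →
    to iN ≤PR d → from iC ≤PR d → f ≤PR d
  decode-via A iN iC to≤ from≤ = decode (≅-trans (≅-sym iC) iN)
    (PrimRec⇒≤PR (≤PR⇒PrimRec to≤ (≤PR⇒PrimRec from≤ (var 0F))))

-- From categoricity to the cone

module _ (em : ExcludedMiddle 0ℓ) where

  blocks⇒ωη : ∀ {_⊏_ : ℕ → ℕ → Set} → Blocks _⊏_ → _<ωη_ ≅ _⊏_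
  blocks⇒ωη B = ≅-sym (Classification.classify em val val-surjective B)

  opaque
    standard-ωη : _<ωη_ ≅ Rel (proj₁ Standard.standard)
    standard-ωη = blocks⇒ωη (equiv-blocks (proj₂ Standard.standard) Standard.standard-blocks)

    coded-ωη : ∀ f (Σ3f : Σ3Graph f) → _<ωη_ ≅ Rel (Decoding.C em f Σ3f)
    coded-ωη f Σ3f = blocks⇒ωη (Decoding.C-blocks em f Σ3f)

  prCat⇒cone : ∀ A → _<ωη_ ≅ Rel A → ∀ d → PrCat A d → Cone d
  prCat⇒cone A i d cat f (Σ3f , _) = D.decode-via A (proj₁ iN) (proj₁ iC) (proj₁ (proj₂ iN)) (proj₂ (proj₂ iC))
    where
    module D = Decoding em f Σ3f
    iN : Σ (Rel A ≅ Rel (proj₁ Standard.standard)) λ j → to j ≤PR d × from j ≤PR d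
    iN = cat (proj₁ Standard.standard) (≅-trans (≅-sym i) standard-ωη)
    iC : Σ (Rel A ≅ Rel D.C) λ j → to j ≤PR d × from j ≤PR d
    iC = cat D.C (≅-trans (≅-sym i) (coded-ωη f Σ3f))

theorem3p4 : ExcludedMiddle 0ℓ →
    (Σ Punctual λ A → _<ωη_ ≅ Rel A)
    × (∀ (A : Punctual) → _<ωη_ ≅ Rel A →
    ∀ (d : ℕ → ℕ) → (PrCat A d → Cone d) × (Cone d → PrCat A d))
theorem3p4 em = (proj₁ Standard.standard , standard-ωη em) ,
  λ A i d → prCat⇒cone em A i d , cone⇒prCat em A i d
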